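{- Let $G_n$ be a depth-two claw with $n$ leaves and let $1 \leq r \leq n-1$. Then $G_n$ is $r$-EKR. Moreover, if $4 \leq r < n-1$, then $G_n$ is strictly $r$-EKR.
   Context: A depth-two claw with $n$ leaves, $G_n$, is the tree with a root $c$ adjacent to vertices $b_1,\dots,b_n$, where each $b_i$ is adjacent to exactly one further vertex $a_i$ (a leaf); equivalently a star $K_{1,n}$ with every edge subdivided. An $r$-independent set is an independent set of size $r$. A family of sets is intersecting if every two members meet. A canonically intersecting family is the family of all $r$-independent sets containing a fixed vertex. A graph is $r$-EKR if the maximum size of an intersecting family of $r$-independent sets equals the maximum size of a canonically intersecting family; it is strictly $r$-EKR if moreover every intersecting family of $r$-independent sets of maximum size is canonically intersecting. (In $G_n$ a largest canonically intersecting family is the one for a leaf, of size $\binom{n-1}{r-1}2^{r-1}+\binom{n-1}{r-2}$.) -}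

module Defs where

import Data.Fin as Fin
open import Data.Fin using (Fin; zero; suc; splitAt)
open import Data.Fin.Subset using (Subset; _∈_; _∩_; ∣_∣; Nonempty)
open import Data.List using (List; length)
import Data.List.Membership.Propositional as List
open import Data.List.Relation.Unary.Unique.Propositional using (Unique)
open import Data.Nat using (ℕ; _+_; _≤_)
open import Data.Product using (_×_; ∃-syntax)
open import Data.Sum using ([_,_]′)
open import Function using (_on_)
open import Function.Bundles using (_⇔_)
open import Level using (0ℓ)
open import Relation.Binary using (Rel; Symmetric; Irreflexive; Decidable)
open import Relation.Binary.PropositionalEquality using (_≡_; refl)
open import Relation.Nullary using (¬_; yes; no)

record Graph : Set₁ where
  field
    order     : ℕ
    _~_       : Rel (Fin order) 0ℓ
    ~-sym     : Symmetric _~_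
    ~-irrefl  : Irreflexive _≡_ _~_
    _~?_      : Decidable _~_

-- A finite family of subsets: a duplicate-free list, of which only the
-- membership relation and the length are ever used.
record Family (m : ℕ) : Set where
  field
    members : List (Subset m)
    unique  : Unique members

  size : ℕ
  size = length members

open Family public using (size)

infix 4 _∈ᶠ_
_∈ᶠ_ : ∀ {m} → Subset m → Family m → Set
A ∈ᶠ F = A List.∈ Family.members F

IsMaxSize : ∀ {m} → (Family m → Set) → ℕ → Set
IsMaxSize P k = (∃[ F ] P F × size F ≡ k) × (∀ F → P F → size F ≤ k)

module _ (G : Graph) where
  open Graph G

  Independent : Subset order → Set
  Independent A = ∀ {x y} → x ∈ A → y ∈ A → ¬ (x ~ y)

  IndependentOfSize : ℕ → Subset order → Set
  IndependentOfSize r A = Independent A × ∣ A ∣ ≡ r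

  -- A and B may coincide here; this only matters for r = 0, since a
  -- nonempty set meets itself.
  IntersectingFamily : ℕ → Family order → Set
  IntersectingFamily r F =
    (∀ {A} → A ∈ᶠ F → IndependentOfSize r A) ×
    (∀ {A B} → A ∈ᶠ F → B ∈ᶠ F → Nonempty (A ∩ B))

  CanonicallyIntersecting : ℕ → Family order → Set
  CanonicallyIntersecting r F =
    ∃[ v ] (∀ A → A ∈ᶠ F ⇔ (IndependentOfSize r A × v ∈ A))

  EKR : ℕ → Set
  EKR r = ∃[ k ] IsMaxSize (IntersectingFamily r) k
               × IsMaxSize (CanonicallyIntersecting r) k

  StrictlyEKR : ℕ → Set
  StrictlyEKR r = EKR r ×
    (∀ F → IntersectingFamily r F →
           IsMaxSize (IntersectingFamily r) (size F) →
           CanonicallyIntersecting r F)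

data ClawVertex (n : ℕ) : Set where
  c : ClawVertex n
  b : Fin n → ClawVertex n
  a : Fin n → ClawVertex n

data ClawAdj {n : ℕ} : Rel (ClawVertex n) 0ℓ where
  cb : ∀ i → ClawAdj c (b i)
  bc : ∀ i → ClawAdj (b i) c
  ba : ∀ i → ClawAdj (b i) (a i)
  ab : ∀ i → ClawAdj (a i) (b i)

-- The bijection Fin (1 + (n + n)) → ClawVertex n listing the vertices as
-- c, b₁, …, bₙ, a₁, …, aₙ.
clawVertex : ∀ n → Fin (1 + (n + n)) → ClawVertex n
clawVertex n zero    = c
clawVertex n (suc i) = [ b , a ]′ (splitAt n i)

clawAdj-sym : ∀ {n} → Symmetric (ClawAdj {n})
clawAdj-sym (cb i) = bc i
clawAdj-sym (bc i) = cb i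
clawAdj-sym (ba i) = ab i
clawAdj-sym (ab i) = ba i

clawAdj-irrefl : ∀ {n} → Irreflexive _≡_ (ClawAdj {n})
clawAdj-irrefl refl ()

clawAdj? : ∀ {n} → Decidable (ClawAdj {n})
clawAdj? c     c     = no λ ()
clawAdj? c     (b i) = yes (cb i)
clawAdj? c     (a i) = no λ ()
clawAdj? (b i) c     = yes (bc i)
clawAdj? (b i) (b j) = no λ ()
clawAdj? (b i) (a j) with i Fin.≟ j
... | yes refl = yes (ba i)
... | no i≢j   = no λ { (ba _) → i≢j refl }
clawAdj? (a i) c     = no λ ()
clawAdj? (a i) (b j) with i Fin.≟ j
... | yes refl = yes (ab i)
... | no i≢j   = no λ { (ab _) → i≢j refl }
clawAdj? (a i) (a j) = no λ ()

depthTwoClaw : ℕ → Graph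
depthTwoClaw n = record
  { order    = 1 + (n + n)
  ; _~_      = ClawAdj on clawVertex n
  ; ~-sym    = clawAdj-sym
  ; ~-irrefl = λ { refl → clawAdj-irrefl refl }
  ; _~?_     = λ x y → clawAdj? (clawVertex n x) (clawVertex n y)
  }

{-# OPTIONS --safe #-}
-- Compressing b_i to a_i for every i makes an intersecting family meet outside the b's, so that it
-- projects to an intersecting family of sets of the form S or {c} ∪ S, S a set of leaves. A set S of
-- size j comes from at most C(n-j, n-r) independent r-sets, and {c} ∪ S from at most one, if j = r-1.
-- For a family of subsets of {0, …, m} shift 0 to every other point. Two sets S ∪ {0}, T ∪ {0} with
-- S, T disjoint then have S ∪ T = {1, …, m}; of S and T keep only the smaller. Erasing 0 leaves an
-- intersecting family whose weight has not dropped, provided the weights are monotone in size. Used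
-- once this removes c, and iterated it proves Erdős–Ko–Rado for every antitone weight.
-- If no leaf set is a singleton, the weight of singletons may be lowered to that of pairs, which makes
-- the bound strict; r ≥ 4 keeps the lowered weights monotone once c is merged in. Otherwise
-- the compressed family is a star at some a_x, and so was the original one: undoing the compression
-- at x, a set S containing b_x cannot belong to the family, because reflecting S at x twice replaces
-- a leaf of S by a b-vertex until no leaf is left, and such a set misses an r-set containing c and a_x.
module Submission where

open import Defs
open import Data.Bool using (Bool; true; false; _∧_; _∨_; not; if_then_else_)
import Data.Bool as Bool
open import Data.Bool.Properties using (not-involutive; ∨-zeroʳ; ∧-identityʳ; ∧-zeroʳ; ¬-not)
open import Data.Empty using (⊥-elim)
open import Data.Fin using (Fin; zero; suc; _↑ˡ_; _↑ʳ_)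
import Data.Fin as Fin
open import Data.Fin.Properties using (any?; all?; splitAt-↑ˡ; splitAt-↑ʳ; splitAt⁻¹-↑ˡ; splitAt⁻¹-↑ʳ)
open import Data.Fin.Subset using (Subset; ∣_∣; ∁)
import Data.Fin.Subset as Subset
open import Data.Fin.Subset.Properties using (∣⊥∣≡0; ∣∁p∣≡n∸∣p∣; anySubset?; x∈p∩q⁺; x∈p∩q⁻)
open import Data.List using (List; []; _∷_; allFin; length; map) renaming (_++_ to _++ᴸ_)
open import Data.List.Properties using (length-++; length-map)
import Data.List.Membership.DecPropositional as DecMembership
open import Data.List.Membership.Propositional using (_∈_)
open import Data.List.Membership.Propositional.Properties
  using (∈-allFin; ∈-map⁺; ∈-map⁻; ∈-++⁺ˡ; ∈-++⁺ʳ; ∈-++⁻)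
open import Data.List.Relation.Unary.All as All using ([]; _∷_)
open import Data.List.Relation.Unary.AllPairs using ([]; _∷_)
open import Data.List.Relation.Unary.Any using (here; there)
open import Data.List.Relation.Unary.Unique.Propositional using (Unique)
import Data.List.Relation.Unary.Unique.Propositional.Properties as Unique
open import Data.Nat using (ℕ; zero; suc; _+_; _*_; _∸_; _≤_; _<_; z≤n; s≤s; _≤?_)
open import Data.Nat.Combinatorics using (_C_; nCn≡1; nCk≡nC[n∸k]; k>n⇒nCk≡0; nCk+nC[k+1]≡[n+1]C[k+1])
open import Data.Nat.Properties
open import Algebra.Properties.CommutativeSemigroup +-commutativeSemigroup
  using () renaming (interchange to +-interchange)
open import Data.Product using (_×_; _,_; proj₁; proj₂; ∃-syntax)
open import Data.Sum using (_⊎_; inj₁; inj₂; [_,_]′)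
open import Data.Unit using (⊤; tt)
open import Data.Vec using ([]; _∷_; lookup; _[_]≔_; _++_; splitAt)
open import Data.Vec.Properties
open import Function using (_∘_)
open import Function.Bundles using (mk⇔; Equivalence)
open import Relation.Binary.PropositionalEquality
open import Relation.Nullary using (¬_; yes; no; does; Dec)
open import Relation.Nullary.Decidable using (_×-dec_; _→-dec_; ¬?; map′; dec-true; dec-false)

private variable
  m n r : ℕ

-- Sums over all subsets

∑ : (Subset m → ℕ) → ℕ
∑ {zero}  g = g []
∑ {suc m} g = ∑ (λ S → g (false ∷ S)) + ∑ (λ S → g (true ∷ S))

∑-mono : {g h : Subset m → ℕ} → (∀ S → g S ≤ h S) → ∑ g ≤ ∑ h
∑-mono {zero}  g≤h = g≤h []
∑-mono {suc m} g≤h = +-mono-≤ (∑-mono (λ S → g≤h (false ∷ S))) (∑-mono (λ S → g≤h (true ∷ S)))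

∑-cong : {g h : Subset m → ℕ} → (∀ S → g S ≡ h S) → ∑ g ≡ ∑ h
∑-cong {zero}  g≗h = g≗h []
∑-cong {suc m} g≗h = cong₂ _+_ (∑-cong (λ S → g≗h (false ∷ S))) (∑-cong (λ S → g≗h (true ∷ S)))

∑-distrib-+ : (g h : Subset m → ℕ) → ∑ (λ S → g S + h S) ≡ ∑ g + ∑ h
∑-distrib-+ {zero}  g h = refl
∑-distrib-+ {suc m} g h = trans
  (cong₂ _+_ (∑-distrib-+ (λ S → g (false ∷ S)) (λ S → h (false ∷ S)))
             (∑-distrib-+ (λ S → g (true ∷ S)) (λ S → h (true ∷ S))))
  (+-interchange (∑ (λ S → g (false ∷ S))) _ _ _)

∑-zero : ∀ m → ∑ {m} (λ _ → 0) ≡ 0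
∑-zero zero    = refl
∑-zero (suc m) = cong₂ _+_ (∑-zero m) (∑-zero m)

∑-comm : (g : Subset m → Subset n → ℕ) → ∑ (λ S → ∑ (g S)) ≡ ∑ (λ T → ∑ (λ S → g S T))
∑-comm {zero}  g = refl
∑-comm {suc m} g = trans
  (cong₂ _+_ (∑-comm (λ S → g (false ∷ S))) (∑-comm (λ S → g (true ∷ S))))
  (sym (∑-distrib-+ (λ T → ∑ (λ S → g (false ∷ S) T)) _))

∑-++ : ∀ m (g : Subset (m + n) → ℕ) → ∑ g ≡ ∑ {m} (λ S → ∑ (λ T → g (S ++ T)))
∑-++ zero    g = refl
∑-++ (suc m) g = cong₂ _+_ (∑-++ m _) (∑-++ m _)

∑-∁ : (g : Subset m → ℕ) → ∑ (g ∘ ∁) ≡ ∑ g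
∑-∁ {zero}  g = refl
∑-∁ {suc m} g = trans (cong₂ _+_ (∑-∁ (λ S → g (true ∷ S))) (∑-∁ (λ S → g (false ∷ S))))
  (+-comm (∑ (λ S → g (true ∷ S))) _)

squeeze : ∀ {i j k l} → i ≤ k → j ≤ l → k + l ≤ i + j → k ≤ i × l ≤ j
squeeze {i} {j} {k} {l} i≤k j≤l k+l≤i+j =
  +-cancelʳ-≤ l k i (≤-trans k+l≤i+j (+-monoʳ-≤ i j≤l)) ,
  +-cancelˡ-≤ k l j (≤-trans k+l≤i+j (+-monoˡ-≤ j i≤k))

-- A termwise inequality whose totals compare the other way is an equality at every term. This turns
-- a tight bound into information about single sets.
∑-squeeze : {g h : Subset m → ℕ} → (∀ S → g S ≤ h S) → ∑ h ≤ ∑ g → ∀ S → h S ≤ g S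
∑-squeeze g≤h ∑h≤∑g [] = ∑h≤∑g
∑-squeeze {g = g} {h} g≤h ∑h≤∑g (x ∷ S)
  with squeeze (∑-mono (λ S → g≤h (false ∷ S))) (∑-mono (λ S → g≤h (true ∷ S))) ∑h≤∑g
∑-squeeze g≤h ∑h≤∑g (false ∷ S) | le , _ = ∑-squeeze (λ S → g≤h (false ∷ S)) le S
∑-squeeze g≤h ∑h≤∑g (true ∷ S)  | _ , le = ∑-squeeze (λ S → g≤h (true ∷ S)) le S

-- Summing the hypothesis over all `S` counts each side twice, as `σ` preserves sums. It is applied
-- to swaps and to complementation.
∑-paired-≤ : (σ : Subset m → Subset m) → (∀ g → ∑ (g ∘ σ) ≡ ∑ g) → {g h : Subset m → ℕ} →
             (∀ S → g S + g (σ S) ≤ h S + h (σ S)) → ∑ g ≤ ∑ h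
∑-paired-≤ σ ∑σ {g} {h} le = *-cancelˡ-≤ 2 (subst₂ _≤_ (doubled g) (doubled h) (∑-mono le))
  where
  doubled : ∀ g → ∑ (λ S → g S + g (σ S)) ≡ 2 * ∑ g
  doubled g = trans (∑-distrib-+ g (g ∘ σ)) (cong (∑ g +_) (trans (∑σ g) (sym (+-identityʳ _))))

-- Truth values as coefficients, and sizes after changing one element

infixr 7 _·_
_·_ : Bool → ℕ → ℕ
β · k = if β then k else 0

·-≤ : ∀ β k → β · k ≤ k
·-≤ true  k = ≤-refl
·-≤ false k = z≤n

·-mono : ∀ {β γ} k → (β ≡ true → γ ≡ true) → β · k ≤ γ · k
·-mono {false} k imp = z≤n
·-mono {true}  k imp rewrite imp refl = ≤-refl

·1-cancel : ∀ {β γ} → β · 1 ≤ γ · 1 → β ≡ true → γ ≡ true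
·1-cancel {γ = true} le refl = refl
·1-cancel {γ = false} () refl

-- Stated additively, it covers insertion, removal and no change at once, without truncated
-- subtraction.
∣[]≔∣ : (S : Subset m) (i : Fin m) (x : Bool) →
        ∣ S [ i ]≔ x ∣ + lookup S i · 1 ≡ ∣ S ∣ + x · 1
∣[]≔∣ (false ∷ S) zero false = refl
∣[]≔∣ (false ∷ S) zero true  = trans (+-identityʳ _) (+-comm 1 _)
∣[]≔∣ (true ∷ S)  zero false = trans (+-comm _ 1) (sym (+-identityʳ _))
∣[]≔∣ (true ∷ S)  zero true  = refl
∣[]≔∣ (false ∷ S) (suc i) x = ∣[]≔∣ S i x
∣[]≔∣ (true ∷ S)  (suc i) x = cong suc (∣[]≔∣ S i x)

∣insert∣ : (S : Subset m) {i : Fin m} → lookup S i ≡ false → ∣ S [ i ]≔ true ∣ ≡ suc ∣ S ∣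
∣insert∣ S {i} i∉S with eq ← ∣[]≔∣ S i true rewrite i∉S =
  trans (sym (+-identityʳ _)) (trans eq (+-comm _ 1))

∣remove∣ : (S : Subset m) {i : Fin m} → lookup S i ≡ true → suc ∣ S [ i ]≔ false ∣ ≡ ∣ S ∣
∣remove∣ S {i} i∈S with eq ← ∣[]≔∣ S i false rewrite i∈S =
  trans (+-comm 1 _) (trans eq (+-identityʳ _))

lookup-insert : (S : Subset m) (i : Fin m) {j : Fin m} →
                lookup (S [ i ]≔ true) j ≡ true → j ≡ i ⊎ lookup S j ≡ true
lookup-insert S i {j} j∈ with j Fin.≟ i
... | yes j≡i = inj₁ j≡i
... | no j≢i  = inj₂ (trans (sym (lookup∘update′ j≢i S true)) j∈)

lookup-remove : (S : Subset m) (i : Fin m) {j : Fin m} →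
                lookup (S [ i ]≔ false) j ≡ true → j ≢ i × lookup S j ≡ true
lookup-remove S i {j} j∈ with j Fin.≟ i
... | yes refl with () ← trans (sym j∈) (lookup∘update i S false)
... | no j≢i  = j≢i , trans (sym (lookup∘update′ j≢i S false)) j∈

lookup-ext : {S T : Subset m} → (∀ i → lookup S i ≡ lookup T i) → S ≡ T
lookup-ext {S = []}    {[]}    eq = refl
lookup-ext {S = x ∷ S} {y ∷ T} eq = cong₂ _∷_ (eq zero) (lookup-ext (eq ∘ suc))

-- Shifting

-- Exchanging the two values, rather than moving one point, gives an involution on all subsets, also
-- when `p` and `q` coincide.
swap : Fin m → Fin m → Subset m → Subset m
swap p q S = (S [ p ]≔ lookup S q) [ q ]≔ lookup S p

module _ (p q : Fin m) where

  lookup-swap-q : ∀ S → lookup (swap p q S) q ≡ lookup S p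
  lookup-swap-q S = lookup∘update q (S [ p ]≔ lookup S q) _

  lookup-swap-p : ∀ S → lookup (swap p q S) p ≡ lookup S q
  lookup-swap-p S with p Fin.≟ q
  ... | yes refl = lookup-swap-q S
  ... | no p≢q   = trans (lookup∘update′ p≢q (S [ p ]≔ lookup S q) _) (lookup∘update p S _)

  lookup-swap-≢ : ∀ S {y} → y ≢ p → y ≢ q → lookup (swap p q S) y ≡ lookup S y
  lookup-swap-≢ S y≢p y≢q =
    trans (lookup∘update′ y≢q (S [ p ]≔ lookup S q) _) (lookup∘update′ y≢p S _)

  swap-involutive : ∀ S → swap p q (swap p q S) ≡ S
  swap-involutive S = lookup-ext ptwise
    where
    ptwise : ∀ y → lookup (swap p q (swap p q S)) y ≡ lookup S y
    ptwise y with y Fin.≟ p | y Fin.≟ q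
    ... | yes refl | _        = trans (lookup-swap-p (swap p q S)) (lookup-swap-q S)
    ... | no _     | yes refl = trans (lookup-swap-q (swap p q S)) (lookup-swap-p S)
    ... | no y≢p   | no y≢q   = trans (lookup-swap-≢ (swap p q S) y≢p y≢q) (lookup-swap-≢ S y≢p y≢q)

  ∣swap∣ : ∀ S → ∣ swap p q S ∣ ≡ ∣ S ∣
  ∣swap∣ S with p Fin.≟ q
  ... | yes refl = cong ∣_∣ (lookup-ext {S = swap p p S} {S} λ y → ptwise y (y Fin.≟ p))
    where
    ptwise : ∀ y → _ → lookup (swap p p S) y ≡ lookup S y
    ptwise y (yes refl) = lookup-swap-p S
    ptwise y (no y≢p)   = lookup-swap-≢ S y≢p y≢p
  ... | no p≢q = +-cancelʳ-≡ (lookup S q · 1) _ _ (+-cancelʳ-≡ (lookup S p · 1) _ _ (begin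
      ∣ swap p q S ∣ + lookup S q · 1 + lookup S p · 1
        ≡⟨ cong (λ β → ∣ swap p q S ∣ + β · 1 + lookup S p · 1)
                (lookup∘update′ (p≢q ∘ sym) S _) ⟨
      ∣ swap p q S ∣ + lookup (S [ p ]≔ lookup S q) q · 1 + lookup S p · 1
        ≡⟨ cong (_+ lookup S p · 1) (∣[]≔∣ (S [ p ]≔ lookup S q) q (lookup S p)) ⟩
      ∣ S [ p ]≔ lookup S q ∣ + lookup S p · 1 + lookup S p · 1
        ≡⟨ cong (_+ lookup S p · 1) (∣[]≔∣ S p (lookup S q)) ⟩
      ∣ S ∣ + lookup S q · 1 + lookup S p · 1 ∎))
    where open ≡-Reasoning

-- The induction freezes the second coordinate, which the swap does not touch when `j` is a
-- successor, and regroups the four quarters of the sum around it.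
∑-swap₀ : (j : Fin m) (g : Subset (suc m) → ℕ) → ∑ (g ∘ swap zero (suc j)) ≡ ∑ g
∑-swap₀ zero    g = +-interchange (∑ (λ S → g (false ∷ false ∷ S))) _ _ _
∑-swap₀ (suc j) g = begin
  (W + X) + (Y + Z)                         ≡⟨ +-interchange W X Y Z ⟩
  (W + Y) + (X + Z)
    ≡⟨ cong₂ _+_ (∑-swap₀ j (g₁ false)) (∑-swap₀ j (g₁ true)) ⟩
  ∑ (g₁ false) + ∑ (g₁ true)                ≡⟨ +-interchange (∑ (λ S → g₁ false (false ∷ S))) _ _ _ ⟩
  ∑ g ∎
  where
  open ≡-Reasoning
  g₁ : Bool → Subset _ → ℕ
  g₁ y (x ∷ S) = g (x ∷ y ∷ S)
  W = ∑ (λ S → g₁ false (swap zero (suc j) (false ∷ S)))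
  X = ∑ (λ S → g₁ true (swap zero (suc j) (false ∷ S)))
  Y = ∑ (λ S → g₁ false (swap zero (suc j) (true ∷ S)))
  Z = ∑ (λ S → g₁ true (swap zero (suc j) (true ∷ S)))

∑-swap : (p q : Fin m) (g : Subset m → ℕ) → ∑ (g ∘ swap p q) ≡ ∑ g
∑-swap zero    zero    g = refl
∑-swap zero    (suc q) g = ∑-swap₀ q g
∑-swap (suc p) zero    g = ∑-swap₀ p g
∑-swap (suc p) (suc q) g = cong₂ _+_ (∑-swap p q (λ S → g (false ∷ S))) (∑-swap p q (λ S → g (true ∷ S)))

-- The arguments are whether `p` and `q` lie in a set, then whether the set and its swap lie in the
-- family. A set with `p` only stays if its swap is present too; a set with `q` only is in if either
-- is.
shiftValue : Bool → Bool → Bool → Bool → Bool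
shiftValue true  false β γ = β ∧ γ
shiftValue false true  β γ = β ∨ γ
shiftValue _     _     β γ = β

-- The shift keeps the number of members in the pair formed by a set and its swap; a lone member
-- ends at the set containing the second point, which is the heavier one.
shiftValue-≤ : ∀ s t β γ {k l} →
  (s ≡ true → t ≡ false → k ≤ l) → (s ≡ false → t ≡ true → l ≤ k) →
  β · k + γ · l ≤ shiftValue s t β γ · k + shiftValue t s γ β · l
shiftValue-≤ true  true  β     γ     _   _   = ≤-refl
shiftValue-≤ false false β     γ     _   _   = ≤-refl
shiftValue-≤ true  false true  true  _   _   = ≤-refl
shiftValue-≤ true  false true  false {k} k≤l _ = ≤-trans (≤-reflexive (+-identityʳ k)) (k≤l refl refl)
shiftValue-≤ true  false false true  _   _   = ≤-refl
shiftValue-≤ true  false false false _   _   = ≤-refl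
shiftValue-≤ false true  true  true  _   _   = ≤-refl
shiftValue-≤ false true  true  false _   _   = ≤-refl
shiftValue-≤ false true  false true  _   l≤k = ≤-trans (l≤k refl refl) (m≤m+n _ 0)
shiftValue-≤ false true  false false _   _   = ≤-refl

-- Moves p to q wherever this leaves the family and does not collide with it.
shift : Fin m → Fin m → (Subset m → Bool) → Subset m → Bool
shift p q f S = shiftValue (lookup S p) (lookup S q) (f S) (f (swap p q S))

∑-shift : (p q : Fin m) (f : Subset m → Bool) (u : Subset m → ℕ) →
  (∀ S → lookup S p ≡ true → lookup S q ≡ false → u S ≤ u (swap p q S)) →
  ∑ (λ S → f S · u S) ≤ ∑ (λ S → shift p q f S · u S)
∑-shift p q f u u≤ = ∑-paired-≤ (swap p q) (∑-swap p q) paired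
  where
  u≥ : ∀ S → lookup S p ≡ false → lookup S q ≡ true → u (swap p q S) ≤ u S
  u≥ S p∉S q∈S = subst (λ T → u (swap p q S) ≤ u T) (swap-involutive p q S)
    (u≤ (swap p q S) (trans (lookup-swap-p p q S) q∈S) (trans (lookup-swap-q p q S) p∉S))
  paired : ∀ S → f S · u S + f (swap p q S) · u (swap p q S) ≤
                 shift p q f S · u S + shift p q f (swap p q S) · u (swap p q S)
  paired S rewrite swap-involutive p q S | lookup-swap-p p q S | lookup-swap-q p q S =
    shiftValue-≤ (lookup S p) (lookup S q) (f S) (f (swap p q S)) (u≤ S) (u≥ S)

-- `M` restricts where a common point may lie: anywhere for plain intersection, outside the
-- b-vertices after compression.
Meeting : (Fin m → Set) → (Subset m → Bool) → Set
Meeting M f = ∀ S T → f S ≡ true → f T ≡ true →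
  ∃[ y ] lookup S y ≡ true × lookup T y ≡ true × M y

true≢false : ∀ {β} → β ≡ true → ¬ (β ≡ false)
true≢false refl ()

separated : (S : Subset m) {y z : Fin m} → lookup S z ≡ false → lookup S y ≡ true → y ≢ z
separated S z∉S y∈S refl = true≢false y∈S z∉S

module _ (p q : Fin m) (f : Subset m → Bool) where

  shift-unmoved : ∀ S → shift p q f S ≡ true → lookup S q ≡ false → f S ≡ true
  shift-unmoved S s∈ q∉ with lookup S p | lookup S q | f S
  shift-unmoved S s∈ refl | false | false | _    = s∈
  shift-unmoved S s∈ refl | true  | false | true = refl

  shift-origin : ∀ S → shift p q f S ≡ true →
    f S ≡ true ⊎ (lookup S p ≡ false × lookup S q ≡ true × f (swap p q S) ≡ true)
  shift-origin S s∈ with lookup S p | lookup S q | f S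
  ... | true  | true  | true  = inj₁ refl
  ... | true  | false | true  = inj₁ refl
  ... | false | _     | true  = inj₁ refl
  ... | false | true  | false = inj₂ (refl , refl , s∈)

  shift-image : ∀ S → f S ≡ true → shift p q f S ≡ true ⊎ shift p q f (swap p q S) ≡ true
  shift-image S S∈
    rewrite swap-involutive p q S | lookup-swap-p p q S | lookup-swap-q p q S | S∈
    with lookup S p | lookup S q | f (swap p q S)
  ... | true  | true  | _     = inj₁ refl
  ... | true  | false | true  = inj₁ refl
  ... | true  | false | false = inj₂ refl
  ... | false | true  | _     = inj₁ refl
  ... | false | false | _     = inj₁ refl

  shift-blocked : ∀ S → shift p q f S ≡ true → lookup S p ≡ true → lookup S q ≡ false →
    f (swap p q S) ≡ true
  shift-blocked S s∈ p∈ q∉ rewrite p∈ | q∉ with f S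
  ... | true = s∈

  shift-containing-p : ∀ S → shift p q f S ≡ true → lookup S p ≡ true → f S ≡ true
  shift-containing-p S s∈ p∈ with shift-origin S s∈
  ... | inj₁ fS           = fS
  ... | inj₂ (p∉ , _ , _) = ⊥-elim (true≢false p∈ p∉)

  -- As `S` lacks `q` it was not moved, and if it contains `p` then its swap is in the family as
  -- well. According to whether `T` was moved, `S` or its swap is met with `T` or with the swap of
  -- `T`, so that the common point can be carried back.
  shift-meeting-half : ∀ {M} → Meeting M f → ∀ S T → lookup S q ≡ false →
    shift p q f S ≡ true → shift p q f T ≡ true →
    ∃[ y ] lookup S y ≡ true × lookup T y ≡ true × M y × (y ≡ p → lookup T q ≡ true)
  shift-meeting-half {M} meet S T q∉S S∈ T∈ = go (lookup S p) (lookup T q) refl refl (shift-origin T T∈)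
    where
    fS = shift-unmoved S S∈ q∉S
    σS = swap p q S
    σT = swap p q T
    unswap : ∀ S {y} → lookup (swap p q S) y ≡ true → y ≢ p → y ≢ q → lookup S y ≡ true
    unswap S y∈ y≢p y≢q = trans (sym (lookup-swap-≢ p q S y≢p y≢q)) y∈
    p∉σS : lookup σS p ≡ false
    p∉σS = trans (lookup-swap-p p q S) q∉S
    go : ∀ s t → lookup S p ≡ s → lookup T q ≡ t →
      f T ≡ true ⊎ (lookup T p ≡ false × lookup T q ≡ true × f σT ≡ true) →
      ∃[ y ] lookup S y ≡ true × lookup T y ≡ true × M y × (y ≡ p → lookup T q ≡ true)
    go false _ p∉S _ (inj₁ fT) with y , y∈S , y∈T , My ← meet S T fS fT =
      y , y∈S , y∈T , My , λ y≡p → ⊥-elim (separated S p∉S y∈S y≡p)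
    go false _ p∉S _ (inj₂ (p∉T , q∈T , fσT)) with y , y∈S , y∈σT , My ← meet S σT fS fσT =
      y , y∈S , unswap T y∈σT (separated S p∉S y∈S) (separated S q∉S y∈S) , My , λ _ → q∈T
    go true true p∈S q∈T (inj₁ fT) with y , y∈S , y∈T , My ← meet S T fS fT =
      y , y∈S , y∈T , My , λ _ → q∈T
    go true false p∈S q∉T (inj₁ fT)
      with y , y∈σS , y∈T , My ← meet σS T (shift-blocked S S∈ p∈S q∉S) fT =
      y , unswap S y∈σS (separated σS p∉σS y∈σS) (separated T q∉T y∈T) , y∈T , My ,
      λ y≡p → ⊥-elim (separated σS p∉σS y∈σS y≡p)
    go true _ p∈S _ (inj₂ (p∉T , q∈T , fσT))
      with y , y∈σS , y∈σT , My ← meet σS σT (shift-blocked S S∈ p∈S q∉S) fσT =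
      y , unswap S y∈σS y≢p y≢q , unswap T y∈σT y≢p y≢q , My , λ _ → q∈T
      where
      y≢p = separated σS p∉σS y∈σS
      y≢q = separated σT (trans (lookup-swap-q p q T) p∉T) y∈σT

  -- The last clause is the gain from shifting: a common point `p` comes with `q` in one of the two
  -- sets. For the head element it yields saturation, and for adjacent `p` and `q` it excludes `p`.
  shift-meeting : ∀ {M} → M q → Meeting M f → ∀ S T →
    shift p q f S ≡ true → shift p q f T ≡ true →
    ∃[ y ] lookup S y ≡ true × lookup T y ≡ true × M y ×
           (y ≡ p → lookup S q ≡ true ⊎ lookup T q ≡ true)
  shift-meeting {M} Mq meet S T S∈ T∈ = go (lookup S q) (lookup T q) refl refl
    where
    go : ∀ s t → lookup S q ≡ s → lookup T q ≡ t →
      ∃[ y ] lookup S y ≡ true × lookup T y ≡ true × M y ×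
             (y ≡ p → lookup S q ≡ true ⊎ lookup T q ≡ true)
    go true true  q∈S q∈T = q , q∈S , q∈T , Mq , λ _ → inj₁ q∈S
    go true false q∈S q∉T with y , y∈T , y∈S , My , _ ← shift-meeting-half meet T S q∉T T∈ S∈ =
      y , y∈S , y∈T , My , λ _ → inj₁ q∈S
    go false _    q∉S _   with y , y∈S , y∈T , My , imp ← shift-meeting-half meet S T q∉S S∈ T∈ =
      y , y∈S , y∈T , My , inj₂ ∘ imp

-- The weighted Erdős–Ko–Rado theorem

Intersecting : (Subset m → Bool) → Set
Intersecting = Meeting (λ _ → ⊤)

_⋒_ : Subset m → Subset m → Set
S ⋒ T = ∃[ y ] lookup S y ≡ true × lookup T y ≡ true

_⋒?_ : (S T : Subset m) → Dec (S ⋒ T)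
S ⋒? T = any? (λ y → (lookup S y Bool.≟ true) ×-dec (lookup T y Bool.≟ true))

weight : (w v : ℕ → ℕ) → Subset (suc m) → ℕ
weight w v (false ∷ S) = w ∣ S ∣
weight w v (true ∷ S)  = v ∣ S ∣

Antitone : (ℕ → ℕ) → Set
Antitone w = ∀ j → w (suc j) ≤ w j

antitone-≤ : ∀ {w} → Antitone w → ∀ i d → w (i + d) ≤ w i
antitone-≤ {w} anti i zero    = ≤-reflexive (cong w (+-identityʳ i))
antitone-≤ {w} anti i (suc d) =
  ≤-trans (≤-reflexive (cong w (+-suc i d))) (≤-trans (anti (i + d)) (antitone-≤ anti i d))

-- A family stable under shifting the head element to x is saturated at x.
SaturatedAt : Fin m → (Subset (suc m) → Bool) → Set
SaturatedAt x f = ∀ S T → f (true ∷ S) ≡ true → f (true ∷ T) ≡ true →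
  lookup S x ≡ false → lookup T x ≡ false → S ⋒ T

-- The head is shifted to each point of `X` in turn. Saturation gained earlier persists, because
-- these shifts never create a set containing the head. The hypothesis on `v` says that replacing
-- the head by another point loses no weight.
saturate : ∀ {w v} → (∀ j → v j ≤ w (suc j)) → (X : List (Fin m)) (f : Subset (suc m) → Bool) →
  Intersecting f → ∃[ g ] Intersecting g × (∀ {x} → x ∈ X → SaturatedAt x g) ×
    ∑ (λ S → f S · weight w v S) ≤ ∑ (λ S → g S · weight w v S)
saturate v≤w [] f meet = f , meet , (λ ()) , ≤-refl
saturate {w = w} {v} v≤w (x ∷ X) f meet
  with g , meet-g , sat , f≤g ← saturate {w = w} {v} v≤w X f meet =
  h , meet-h , sat-h , ≤-trans f≤g (∑-shift zero (suc x) g (weight w v) heavier)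
  where
  h = shift zero (suc x) g
  meets = shift-meeting zero (suc x) g {λ _ → ⊤} tt meet-g
  meet-h : Intersecting h
  meet-h S T S∈ T∈ with y , y∈S , y∈T , _ ← meets S T S∈ T∈ = y , y∈S , y∈T , tt
  sat-h : ∀ {z} → z ∈ x ∷ X → SaturatedAt z h
  sat-h (there z∈) S T S∈ T∈ = sat z∈ S T
    (shift-containing-p zero (suc x) g (true ∷ S) S∈ refl)
    (shift-containing-p zero (suc x) g (true ∷ T) T∈ refl)
  sat-h (here refl) S T S∈ T∈ x∉S x∉T with meets (true ∷ S) (true ∷ T) S∈ T∈
  ... | suc y , y∈S , y∈T , _ = y , y∈S , y∈T
  ... | zero , _ , _ , _ , moved with moved refl
  ...   | inj₁ x∈S = ⊥-elim (true≢false x∈S x∉S)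
  ...   | inj₂ x∈T = ⊥-elim (true≢false x∈T x∉T)
  heavier : ∀ S → lookup S zero ≡ true → lookup S (suc x) ≡ false →
    weight w v S ≤ weight w v (swap zero (suc x) S)
  heavier (true ∷ S) _ x∉S rewrite x∉S =
    ≤-trans (v≤w ∣ S ∣) (≤-reflexive (cong w (sym (∣insert∣ S x∉S))))

-- Complementary pairs and the erasure of a point

∁-involutive : (S : Subset m) → ∁ (∁ S) ≡ S
∁-involutive []      = refl
∁-involutive (x ∷ S) = cong₂ _∷_ (not-involutive x) (∁-involutive S)

∁-disjoint : (S : Subset m) → ¬ (S ⋒ ∁ S)
∁-disjoint S (y , y∈S , y∈∁S) rewrite lookup-map y not S | y∈S with () ← y∈∁S

-- Selects the smaller of S and ∁ S; ties are broken by the first element.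
small : Subset (suc m) → Bool
small (true ∷ S)  = does (suc ∣ S ∣ ≤? ∣ ∁ S ∣)
small (false ∷ S) = does (∣ S ∣ ≤? ∣ ∁ S ∣)

≤?-flip : ∀ {i j} (p : Dec (j ≤ i)) (q : Dec (suc i ≤ j)) → does p ≡ not (does q)
≤?-flip (yes j≤i) q = sym (cong not (dec-false q (≤⇒≯ j≤i)))
≤?-flip (no j≰i)  q = sym (cong not (dec-true q (≰⇒> j≰i)))

-- The comparison of sizes is weak for sets with the first element and strict for the others, so
-- exactly one set of each complementary pair is selected, even in a tie.
small-∁ : (S : Subset (suc m)) → small (∁ S) ≡ not (small S)
small-∁ (true ∷ S) rewrite ∁-involutive S = ≤?-flip (∣ ∁ S ∣ ≤? ∣ S ∣) (suc ∣ S ∣ ≤? ∣ ∁ S ∣)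
small-∁ (false ∷ S) rewrite ∁-involutive S =
  trans (sym (not-involutive _)) (cong not (sym (≤?-flip (∣ S ∣ ≤? ∣ ∁ S ∣) (suc ∣ ∁ S ∣ ≤? ∣ S ∣))))

small-≤ : (S : Subset (suc m)) → small S ≡ true → ∣ S ∣ ≤ ∣ ∁ S ∣
small-≤ (true ∷ S) eq  = ≤ᵇ⇒≤ (suc ∣ S ∣) ∣ ∁ S ∣ (subst Bool.T (sym eq) tt)
small-≤ (false ∷ S) eq = m≤n⇒m≤1+n (≤ᵇ⇒≤ ∣ S ∣ ∣ ∁ S ∣ (subst Bool.T (sym eq) tt))

-- The head element 0 is erased; if f contains both {0} ∪ S and {0} ∪ ∁ S, only the smaller of S and ∁ S is kept.
merge : (Subset (2 + m) → Bool) → Subset (suc m) → Bool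
merge f S = f (false ∷ S) ∨ (f (true ∷ S) ∧ (small S ∨ not (f (true ∷ ∁ S))))

module _ {m} (f : Subset (2 + m) → Bool) (meet : Intersecting f)
         (sat : ∀ x → SaturatedAt x f) where

  complementary : ∀ S T → f (true ∷ S) ≡ true → f (true ∷ T) ≡ true → ¬ (S ⋒ T) → T ≡ ∁ S
  complementary S T S∈ T∈ disj = lookup-ext λ y → trans (at y) (sym (lookup-map y not S))
    where
    at : ∀ y → lookup T y ≡ not (lookup S y)
    at y with lookup S y in Sy | lookup T y in Ty
    ... | true  | true  = ⊥-elim (disj (y , Sy , Ty))
    ... | true  | false = refl
    ... | false | true  = refl
    ... | false | false = ⊥-elim (disj (sat y S T S∈ T∈ Sy Ty))

  merge-origin : ∀ S → merge f S ≡ true → f (false ∷ S) ≡ true ⊎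
    (f (true ∷ S) ≡ true × (f (true ∷ ∁ S) ≡ true → small S ≡ true))
  merge-origin S S∈ with f (false ∷ S) | f (true ∷ S) | small S | f (true ∷ ∁ S)
  ... | true  | _    | _     | _     = inj₁ refl
  ... | false | true | true  | _     = inj₂ (refl , λ _ → refl)
  ... | false | true | false | false = inj₂ (refl , λ ())

  meet-tail : ∀ β S T → f (false ∷ S) ≡ true → f (β ∷ T) ≡ true → S ⋒ T
  meet-tail β S T S∈ T∈ with meet (false ∷ S) (β ∷ T) S∈ T∈
  ... | suc y , y∈S , y∈T , _ = y , y∈S , y∈T

  -- Sets that become disjoint must both have lost the head, hence are complementary by saturation.
  -- Both were then kept for being small, which `small-∁` excludes.
  merge-intersecting : Intersecting (merge f)
  merge-intersecting S T S∈ T∈ = let y , y∈S , y∈T = common (merge-origin S S∈) (merge-origin T T∈)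
                                 in y , y∈S , y∈T , tt
    where
    Origin : Subset (suc m) → Set
    Origin S = f (false ∷ S) ≡ true ⊎
      (f (true ∷ S) ≡ true × (f (true ∷ ∁ S) ≡ true → small S ≡ true))
    common : Origin S → Origin T → S ⋒ T
    common (inj₁ S∈)       (inj₁ T∈)       = meet-tail false S T S∈ T∈
    common (inj₁ S∈)       (inj₂ (T∈ , _)) = meet-tail true S T S∈ T∈
    common (inj₂ (S∈ , _)) (inj₁ T∈) with y , y∈T , y∈S ← meet-tail true T S T∈ S∈ = y , y∈S , y∈T
    common (inj₂ (S∈ , smallS)) (inj₂ (T∈ , smallT)) with S ⋒? T
    ... | yes S⋒T = S⋒T
    ... | no disj with refl ← complementary S T S∈ T∈ disj =
      ⊥-elim (true≢false (smallT (subst (λ R → f (true ∷ R) ≡ true) (sym (∁-involutive S)) S∈))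
                         (trans (small-∁ S) (cong not (smallS T∈))))

  module _ {w v : ℕ → ℕ} (anti : Antitone w) (v≤w : ∀ j → v j ≤ w (suc j)) where

    v≤w-≤ : ∀ {i j} → i ≤ j → v j ≤ w i
    v≤w-≤ {i} {j} i≤j = ≤-trans (v≤w j) (≤-trans (anti j)
      (subst (λ k → w k ≤ w i) (m+[n∸m]≡n i≤j) (antitone-≤ {w} anti i _)))

    before after : Subset (suc m) → ℕ
    before S = f (false ∷ S) · w ∣ S ∣ + f (true ∷ S) · v ∣ S ∣
    after S = merge f S · (w ∣ S ∣ + v ∣ S ∣)

    unpaired : ∀ S → (f (true ∷ S) ≡ true → ¬ (f (true ∷ ∁ S) ≡ true)) → before S ≤ after S
    unpaired S un with f (false ∷ S) | f (true ∷ S) | f (true ∷ ∁ S)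
    ... | false | false | _     = z≤n
    ... | false | true  | true  = ⊥-elim (un refl refl)
    ... | false | true  | false rewrite ∨-zeroʳ (small S) = m≤n+m _ _
    ... | true  | β     | _     = +-monoʳ-≤ (w ∣ S ∣) (·-≤ β _)

    -- Neither `S` nor `∁ S` is in the family without the head, since it would miss the other one.
    -- So the weight before is `v ∣ S ∣ + v ∣ ∁ S ∣`, and keeping `S` alone yields
    -- `w ∣ S ∣ + v ∣ S ∣`, no less because `S` is the smaller.
    paired : ∀ S → f (true ∷ S) ≡ true → f (true ∷ ∁ S) ≡ true → small S ≡ true →
      before S + before (∁ S) ≤ after S + after (∁ S)
    paired S S∈ ∁S∈ sm
      rewrite S∈ | ∁S∈ | sm
            | ¬-not (λ e → ∁-disjoint S (meet-tail true S (∁ S) e ∁S∈))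
            | ¬-not (λ e → ∁-disjoint (∁ S) (meet-tail true (∁ S) (∁ (∁ S)) e
                (subst (λ R → f (true ∷ R) ≡ true) (sym (∁-involutive S)) S∈)))
      = ≤-trans (≤-trans (≤-reflexive (+-comm (v ∣ S ∣) _)) (+-monoˡ-≤ _ (v≤w-≤ (small-≤ S sm)))) (m≤m+n _ _)

    merge-heavier : ∑ (λ S → f S · weight w v S) ≤ ∑ after
    merge-heavier = ≤-trans
      (≤-reflexive (sym (∑-distrib-+ (λ S → f (false ∷ S) · w ∣ S ∣) (λ S → f (true ∷ S) · v ∣ S ∣))))
      (∑-paired-≤ ∁ ∑-∁ {before} {after} both)
      where
      both : ∀ S → before S + before (∁ S) ≤ after S + after (∁ S)
      both S with f (true ∷ S) Bool.≟ true | f (true ∷ ∁ S) Bool.≟ true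
      ... | yes S∈ | yes ∁S∈ with small S Bool.≟ true
      ...   | yes sm = paired S S∈ ∁S∈ sm
      -- Here `∁ S` is the small one, so the roles of `S` and `∁ S` are exchanged.
      ...   | no ¬sm = subst₂ _≤_ (trans (cong (λ R → before (∁ S) + before R) (∁-involutive S)) (+-comm (before (∁ S)) _))
                        (trans (cong (λ R → after (∁ S) + after R) (∁-involutive S)) (+-comm (after (∁ S)) _))
                        (paired (∁ S) ∁S∈ (subst (λ R → f (true ∷ R) ≡ true) (sym (∁-involutive S)) S∈)
                          (trans (small-∁ S) (cong not (¬-not ¬sm))))
      both S | no S∉ | _ = +-mono-≤ (unpaired S (λ S∈ _ → S∉ S∈))
        (unpaired (∁ S) (λ _ S∈ → S∉ (subst (λ R → f (true ∷ R) ≡ true) (∁-involutive S) S∈)))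
      both S | _ | no ∁S∉ = +-mono-≤ (unpaired S (λ _ ∁S∈ → ∁S∉ ∁S∈)) (unpaired (∁ S) (λ ∁S∈ _ → ∁S∉ ∁S∈))

eliminate-head : ∀ {w v} → Antitone w → (∀ j → v j ≤ w (suc j)) →
  (f : Subset (2 + m) → Bool) → Intersecting f →
  ∃[ g ] Intersecting g × ∑ (λ S → f S · weight w v S) ≤ ∑ {suc m} (λ S → g S · (w ∣ S ∣ + v ∣ S ∣))
eliminate-head {w = w} {v} anti v≤w f meet
  with g , meet-g , sat , f≤g ← saturate {w = w} {v} v≤w (allFin _) f meet =
  merge g , merge-intersecting g meet-g sat′ , ≤-trans f≤g (merge-heavier g meet-g sat′ {w} {v} anti v≤w)
  where
  sat′ : ∀ x → SaturatedAt x g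
  sat′ x = sat (∈-allFin x)

-- The right side is the weight of all sets through one fixed point. Erasing the head replaces `w j`
-- by `w j + w (suc j)`, which is antitone again, and the right side obeys the same recursion.
weighted-EKR : ∀ m {w} → Antitone w → (f : Subset (suc m) → Bool) → Intersecting f →
  ∑ (λ S → f S · w ∣ S ∣) ≤ ∑ {m} (λ S → w (suc ∣ S ∣))
weighted-EKR zero {w} anti f meet with f (false ∷ []) in ∅∈
... | true with zero , () , _ ← meet (false ∷ []) (false ∷ []) ∅∈ ∅∈
... | false = ·-≤ (f (true ∷ [])) (w 1)
weighted-EKR (suc m) {w} anti f meet
  with g , meet-g , f≤g ← eliminate-head {w = w} {λ j → w (suc j)} anti (λ _ → ≤-refl) f meet =
  ≤-trans f≤g (≤-trans (weighted-EKR m {λ j → w j + w (suc j)} (λ j → +-mono-≤ (anti j) (anti (suc j))) g meet-g)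
    (≤-reflexive (∑-distrib-+ {m} (λ S → w (suc ∣ S ∣)) (λ S → w (2 + ∣ S ∣)))))

-- The first erasure removes a head with its own weight `v`, which will be the root; the remaining
-- points carry the weight `w + v`.
weighted-EKR⁺ : ∀ {w v} → Antitone w → (∀ j → v j ≤ w (suc j)) → Antitone (λ j → w j + v j) →
  (f : Subset (2 + m) → Bool) → Intersecting f →
  ∑ (λ S → f S · weight w v S) ≤ ∑ {m} (λ S → w (suc ∣ S ∣) + v (suc ∣ S ∣))
weighted-EKR⁺ {w = w} {v} anti v≤w anti⁺ f meet
  with g , meet-g , f≤g ← eliminate-head {w = w} {v} anti v≤w f meet =
  ≤-trans f≤g (weighted-EKR _ {λ j → w j + v j} anti⁺ g meet-g)

-- Depth-two claws

∣++∣ : (S : Subset m) (T : Subset n) → ∣ S ++ T ∣ ≡ ∣ S ∣ + ∣ T ∣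
∣++∣ []          T = refl
∣++∣ (true ∷ S)  T = cong suc (∣++∣ S T)
∣++∣ (false ∷ S) T = ∣++∣ S T

inhabited : (S : Subset m) {k : ℕ} → ∣ S ∣ ≡ suc k → ∃[ y ] lookup S y ≡ true
inhabited (true ∷ S)  _  = zero , refl
inhabited (false ∷ S) eq with y , y∈S ← inhabited S eq = suc y , y∈S

uninhabited : (S : Subset m) → ∣ S ∣ ≡ 0 → ∀ {y} → ¬ (lookup S y ≡ true)
uninhabited S eq y∈S = 1+n≢0 (trans (∣remove∣ S y∈S) eq)

outside-both : (S T : Subset m) → ∣ S ∣ + ∣ T ∣ < m → ∃[ y ] lookup S y ≡ false × lookup T y ≡ false
outside-both (false ∷ S) (false ∷ T) _ = zero , refl , refl
outside-both (false ∷ S) (true ∷ T) (s≤s lt)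
  with y , eq ← outside-both S T (≤-trans (≤-reflexive (sym (+-suc ∣ S ∣ ∣ T ∣))) lt) = suc y , eq
outside-both (true ∷ S) (false ∷ T) (s≤s lt) with y , eq ← outside-both S T lt = suc y , eq
outside-both (true ∷ S) (true ∷ T) (s≤s lt)
  with y , eq ← outside-both S T (≤-trans (s≤s (+-monoʳ-≤ ∣ S ∣ (n≤1+n _))) lt) = suc y , eq

position : ClawVertex n → Fin (1 + (n + n))
position     c     = zero
position {n} (b i) = suc (i ↑ˡ n)
position {n} (a i) = suc (n ↑ʳ i)

clawVertex-position : (u : ClawVertex n) → clawVertex n (position u) ≡ u
clawVertex-position     c     = refl
clawVertex-position {n} (b i) = cong [ b , a ]′ (splitAt-↑ˡ n i n)
clawVertex-position {n} (a i) = cong [ b , a ]′ (splitAt-↑ʳ n n i)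

position-clawVertex : (y : Fin (1 + (n + n))) → position (clawVertex n y) ≡ y
position-clawVertex zero = refl
position-clawVertex {n} (suc y) with Fin.splitAt n y in eq
... | inj₁ i = cong suc (splitAt⁻¹-↑ˡ eq)
... | inj₂ i = cong suc (splitAt⁻¹-↑ʳ eq)

position-≢ : {u v : ClawVertex n} → u ≢ v → position u ≢ position v
position-≢ {n} {u} {v} u≢v eq =
  u≢v (trans (sym (clawVertex-position u)) (trans (cong (clawVertex n) eq) (clawVertex-position v)))

infix 4 _∋_
_∋_ : Subset (1 + (n + n)) → ClawVertex n → Set
S ∋ u = lookup S (position u) ≡ true

∋-clawVertex : ∀ n S (y : Fin (1 + (n + n))) → lookup S y ≡ true → S ∋ clawVertex n y
∋-clawVertex n S y y∈S = trans (cong (lookup S) (position-clawVertex {n} y)) y∈S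

-- Independence is spelled out by the two kinds of edges, which makes it a finite check.
record ClawSet (n r : ℕ) (S : Subset (1 + (n + n))) : Set where
  constructor clawSet
  field
    no-ba : ∀ (i : Fin n) → S ∋ b i → ¬ (S ∋ a i)
    no-cb : ∀ (i : Fin n) → S ∋ c {n} → ¬ (S ∋ b i)
    card  : ∣ S ∣ ≡ r

open ClawSet

toClawSet : ∀ {n r S} → IndependentOfSize (depthTwoClaw n) r S → ClawSet n r S
toClawSet {n} {S = S} (indep , card) = clawSet (λ i → apart (ba i)) (λ i → apart (cb i)) card
  where
  apart : ∀ {u v : ClawVertex n} → ClawAdj u v → S ∋ u → ¬ (S ∋ v)
  apart {u} {v} adj u∈ v∈ = indep (lookup⇒[]= _ S u∈) (lookup⇒[]= _ S v∈)
    (subst₂ ClawAdj (sym (clawVertex-position u)) (sym (clawVertex-position v)) adj)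

fromClawSet : ∀ {n r S} → ClawSet n r S → IndependentOfSize (depthTwoClaw n) r S
fromClawSet {n} {S = S} cs = (λ x∈ y∈ adj → apart adj (at x∈) (at y∈)) , card cs
  where
  at : ∀ {y} → y Subset.∈ S → S ∋ clawVertex n y
  at y∈ = ∋-clawVertex n S _ ([]=⇒lookup y∈)
  apart : ∀ {u v : ClawVertex n} → ClawAdj u v → S ∋ u → ¬ (S ∋ v)
  apart (cb i) u∈ v∈ = no-cb cs i u∈ v∈
  apart (bc i) u∈ v∈ = no-cb cs i v∈ u∈
  apart (ba i) u∈ v∈ = no-ba cs i u∈ v∈
  apart (ab i) u∈ v∈ = no-ba cs i v∈ u∈

-- Compression of a b-vertex to its leaf

swapAt : Fin n → Subset (1 + (n + n)) → Subset (1 + (n + n))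
swapAt i = swap (position (b i)) (position (a i))

shiftAt : Fin n → (Subset (1 + (n + n)) → Bool) → Subset (1 + (n + n)) → Bool
shiftAt i = shift (position (b i)) (position (a i))

swapAt-≢ : ∀ (i : Fin n) S (u : ClawVertex n) → u ≢ b i → u ≢ a i → lookup (swapAt i S) (position u) ≡ lookup S (position u)
swapAt-≢ i S u u≢b u≢a = lookup-swap-≢ (position (b i)) (position (a i)) S (position-≢ u≢b) (position-≢ u≢a)

swapAt-a : ∀ (i : Fin n) S → lookup (swapAt i S) (position (a i)) ≡ lookup S (position (b i))
swapAt-a i = lookup-swap-q (position (b i)) (position (a i))

swapAt-b : ∀ (i : Fin n) S → lookup (swapAt i S) (position (b i)) ≡ lookup S (position (a i))
swapAt-b i = lookup-swap-p (position (b i)) (position (a i))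

swapAt-involutive : ∀ (i : Fin n) S → swapAt i (swapAt i S) ≡ S
swapAt-involutive i = swap-involutive (position (b i)) (position (a i))

-- Without `b i` no edge at index `i` can lie in `S`, and the other edges are untouched by the swap.
clawSet-swap : ∀ {n r} (i : Fin n) {S} → lookup S (position (b i)) ≡ false →
  ClawSet n r (swapAt i S) → ClawSet n r S
clawSet-swap {n} i {S} b∉S cs = clawSet no-ba′ no-cb′ (trans (sym (∣swap∣ (position (b i)) (position (a i)) S)) (card cs))
  where
  unswap : ∀ (u : ClawVertex n) → u ≢ b i → u ≢ a i → S ∋ u → swapAt i S ∋ u
  unswap u u≢b u≢a u∈ = trans (swapAt-≢ i S u u≢b u≢a) u∈
  no-ba′ : ∀ (j : Fin n) → S ∋ b j → ¬ (S ∋ a j)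
  no-ba′ j b∈ a∈ with j Fin.≟ i
  ... | yes refl = true≢false b∈ b∉S
  ... | no j≢i = no-ba cs j (unswap (b j) (λ { refl → j≢i refl }) (λ ()) b∈) (unswap (a j) (λ ()) (λ { refl → j≢i refl }) a∈)
  no-cb′ : ∀ (j : Fin n) → S ∋ c {n} → ¬ (S ∋ b j)
  no-cb′ j c∈ b∈ with j Fin.≟ i
  ... | yes refl = true≢false b∈ b∉S
  ... | no j≢i = no-cb cs j (unswap c (λ ()) (λ ()) c∈) (unswap (b j) (λ { refl → j≢i refl }) (λ ()) b∈)

module _ {n r} (i : Fin n) (f : Subset (1 + (n + n)) → Bool) (claw : ∀ S → f S ≡ true → ClawSet n r S) where

  shiftAt-claw : ∀ S → shiftAt i f S ≡ true → ClawSet n r S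
  shiftAt-claw S S∈ with shift-origin (position (b i)) (position (a i)) f S S∈
  ... | inj₁ fS             = claw S fS
  ... | inj₂ (b∉ , _ , fσS) = clawSet-swap i b∉ (claw (swapAt i S) fσS)

join : Bool → Subset n → Subset n → Subset (1 + (n + n))
join β B A = β ∷ (B ++ A)

join-b : ∀ β (B A : Subset n) i → lookup (join β B A) (position (b i)) ≡ lookup B i
join-b β B A i = lookup-++ˡ B A i

join-a : ∀ β (B A : Subset n) i → lookup (join β B A) (position (a i)) ≡ lookup A i
join-a β B A i = lookup-++ʳ B A i

∣join-false∣ : (B A : Subset n) → ∣ join false B A ∣ ≡ ∣ B ∣ + ∣ A ∣
∣join-false∣ = ∣++∣

join-clawSet : (B A : Subset n) → (∀ i → lookup B i ≡ true → ¬ (lookup A i ≡ true)) → ∣ B ∣ + ∣ A ∣ ≡ r →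
  ClawSet n r (join false B A)
join-clawSet B A disj size = clawSet
  (λ i b∈ a∈ → disj i (trans (sym (join-b false B A i)) b∈) (trans (sym (join-a false B A i)) a∈))
  (λ i ()) (trans (∣join-false∣ B A) size)

join-disjoint : ∀ β (B A : Subset n) → ClawSet n r (join β B A) →
  ∀ i → lookup B i ≡ true → ¬ (lookup A i ≡ true)
join-disjoint β B A cs i i∈B i∈A = no-ba cs i (trans (join-b β B A i) i∈B) (trans (join-a β B A i) i∈A)

-- Undoing a compression

Star : Fin n → (Subset (1 + (n + n)) → Bool) → Set
Star x f = ∀ S → f S ≡ true → S ∋ a x

-- Here the compression of `f` at `x` contains every independent `r`-set through `a x`. The aim is
-- that no member of `f` contains `b x`.
module Unshift {n r} (2≤r : 2 ≤ r) (r<n : r < n) (x : Fin n) (f : Subset (1 + (n + n)) → Bool)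
  (claw : ∀ S → f S ≡ true → ClawSet n r S) (meet : Intersecting f)
  (full : ∀ S → ClawSet n r S → S ∋ a x → shiftAt x f S ≡ true) where

  -- Let `K` be the target set with `b x` replaced by `a x`. By `full` it is in the compressed
  -- family, so `K` or the target is in `f`; and `K` is disjoint from the given member.
  reflect : (B A B′ A′ : Subset n) → f (join false B A) ≡ true → lookup B x ≡ true →
    ClawSet n r (join false B′ A′) → lookup B′ x ≡ true →
    (∀ i → i ≢ x → lookup B i ≡ true → ¬ (lookup B′ i ≡ true)) →
    (∀ i → lookup A i ≡ true → ¬ (lookup A′ i ≡ true)) →
    f (join false B′ A′) ≡ true
  reflect B A B′ A′ S∈ x∈B cs x∈B′ disjB disjA =
    [ meets-S , (λ (_ , _ , fσK) → subst (λ R → f R ≡ true) (swapAt-involutive x S′) fσK) ]′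
      (shift-origin (position (b x)) (position (a x)) f K (full K clawK a∈K))
    where
    S  = join false B A
    S′ = join false B′ A′
    K  = swapAt x S′
    b∉K : lookup K (position (b x)) ≡ false
    b∉K = trans (swapAt-b x S′) (trans (join-a false B′ A′ x) (¬-not (join-disjoint false B′ A′ cs x x∈B′)))
    a∈K : K ∋ a x
    a∈K = trans (swapAt-a x S′) (trans (join-b false B′ A′ x) x∈B′)
    clawK : ClawSet n r K
    clawK = clawSet-swap x b∉K (subst (ClawSet n r) (sym (swapAt-involutive x S′)) cs)
    disjoint : ∀ (u : ClawVertex n) → S ∋ u → ¬ (K ∋ u)
    disjoint c ()
    disjoint (b i) b∈S b∈K with i Fin.≟ x
    ... | yes refl = true≢false b∈K b∉K
    ... | no i≢x = disjB i i≢x (trans (sym (join-b false B A i)) b∈S)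
      (trans (sym (join-b false B′ A′ i)) (trans (sym (swapAt-≢ x S′ (b i) (λ { refl → i≢x refl }) (λ ()))) b∈K))
    disjoint (a i) a∈S a∈K with i Fin.≟ x
    ... | yes refl = join-disjoint false B A (claw S S∈) x x∈B (trans (sym (join-a false B A x)) a∈S)
    ... | no i≢x = disjA i (trans (sym (join-a false B A i)) a∈S)
      (trans (sym (join-a false B′ A′ i)) (trans (sym (swapAt-≢ x S′ (a i) (λ ()) (λ { refl → i≢x refl }))) a∈K))
    meets-S : f K ≡ true → f S′ ≡ true
    meets-S fK with y , y∈S , y∈K , _ ← meet S K S∈ fK =
      ⊥-elim (disjoint (clawVertex n y) (∋-clawVertex n S y y∈S)
                                        (∋-clawVertex n K y y∈K))

  ∣B∣+∣A∣≡r : (B A : Subset n) → f (join false B A) ≡ true → ∣ B ∣ + ∣ A ∣ ≡ r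
  ∣B∣+∣A∣≡r B A S∈ = trans (sym (∣join-false∣ B A)) (card (claw _ S∈))

  -- A set containing c is never moved, so K itself lies in the family although it misses S.
  no-leafless : (B A : Subset n) → ∣ A ∣ ≡ 0 → f (join false B A) ≡ true → lookup B x ≡ true →
    ∀ {y} → y ≢ x → ¬ (lookup B y ≡ true)
  no-leafless B A ∣A∣≡0 S∈ x∈B {y} y≢x y∈B = [ meets-S , moved ]′
    (shift-origin (position (b x)) (position (a x)) f K (full K clawK a∈K))
    where
    S = join false B A
    -- All b-vertices become leaves, and `y` gives way to the root so that the size stays `r`; as
    -- `y ≢ x`, the leaf `a x` remains.
    K = join true Subset.⊥ (B [ y ]≔ false)
    b∉K : ∀ (i : Fin n) → ¬ (K ∋ b i)
    b∉K i b∈ with () ← trans (sym b∈) (trans (join-b true Subset.⊥ (B [ y ]≔ false) i) (lookup-replicate i false))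
    a∈K : K ∋ a x
    a∈K = trans (join-a true Subset.⊥ (B [ y ]≔ false) x)
                (trans (lookup∘update′ (y≢x ∘ sym) B false) x∈B)
    clawK : ClawSet n r K
    clawK = clawSet (λ i b∈ _ → b∉K i b∈) (λ i _ → b∉K i) (begin
      suc ∣ Subset.⊥ {n} ++ (B [ y ]≔ false) ∣ ≡⟨ cong suc (∣++∣ (Subset.⊥ {n}) (B [ y ]≔ false)) ⟩
      suc (∣ Subset.⊥ {n} ∣ + ∣ B [ y ]≔ false ∣)    ≡⟨ cong (λ k → suc (k + ∣ B [ y ]≔ false ∣)) (∣⊥∣≡0 n) ⟩
      suc ∣ B [ y ]≔ false ∣                     ≡⟨ ∣remove∣ B y∈B ⟩
      ∣ B ∣                                      ≡⟨ +-identityʳ _ ⟨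
      ∣ B ∣ + 0                                  ≡⟨ cong (∣ B ∣ +_) ∣A∣≡0 ⟨
      ∣ B ∣ + ∣ A ∣                              ≡⟨ ∣B∣+∣A∣≡r B A S∈ ⟩
      r ∎)
      where open ≡-Reasoning
    disjoint : ∀ (u : ClawVertex n) → S ∋ u → ¬ (K ∋ u)
    disjoint c     ()
    disjoint (b i) _ = b∉K i
    disjoint (a i) a∈S _ = uninhabited A ∣A∣≡0 (trans (sym (join-a false B A i)) a∈S)
    meets-S : ¬ (f K ≡ true)
    meets-S fK with y , y∈S , y∈K , _ ← meet S K S∈ fK =
      disjoint (clawVertex n y) (∋-clawVertex n S y y∈S)
                                (∋-clawVertex n K y y∈K)
    moved : ¬ (_ × _ × f (swapAt x K) ≡ true)
    moved (_ , _ , fσK) = no-cb (claw _ fσK) x (swapAt-≢ x K c (λ ()) (λ ()))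
                            (trans (swapAt-b x K) a∈K)

  -- Two reflections trade a leaf of the set for a b-vertex, until no leaf is left.
  descend : ∀ k (B A : Subset n) → ∣ A ∣ ≡ k → f (join false B A) ≡ true → ¬ (lookup B x ≡ true)
  descend zero B A ∣A∣≡0 S∈ x∈B =
    -- From `r ≥ 2` the leafless set has a second b-vertex besides `b x`.
    let y , y∈     = inhabited (B [ x ]≔ false) {r ∸ 2} (suc-injective (begin
                       suc ∣ B [ x ]≔ false ∣ ≡⟨ ∣remove∣ B x∈B ⟩
                       ∣ B ∣                  ≡⟨ +-identityʳ _ ⟨
                       ∣ B ∣ + 0              ≡⟨ cong (∣ B ∣ +_) ∣A∣≡0 ⟨
                       ∣ B ∣ + ∣ A ∣          ≡⟨ ∣B∣+∣A∣≡r B A S∈ ⟩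
                       r                      ≡⟨ m+[n∸m]≡n 2≤r ⟨
                       2 + (r ∸ 2) ∎))
        y≢x , y∈B = lookup-remove B x y∈
    in no-leafless B A ∣A∣≡0 S∈ x∈B y≢x y∈B
    where open ≡-Reasoning
  descend (suc k) B A ∣A∣≡suc S∈ x∈B = descend k B″ A″ ∣A″∣≡k S″∈ x∈B″
    where
    disj = join-disjoint false B A (claw _ S∈)
    x∉A : lookup A x ≡ false
    x∉A = ¬-not (disj x x∈B)
    z-in = inhabited A ∣A∣≡suc
    z = proj₁ z-in
    z∈A = proj₂ z-in
    -- As `r < n`, some index is used by neither part; it takes the place of the leaf `z`.
    y-out = outside-both B A (subst (_< n) (sym (∣B∣+∣A∣≡r B A S∈)) r<n)
    y = proj₁ y-out
    y∉B = proj₁ (proj₂ y-out)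
    y∉A = proj₂ (proj₂ y-out)
    -- The first reflection exchanges the two parts away from `x`. The second exchanges them back,
    -- with `y` added to the b-vertices and `z` removed from the leaves.
    B′ = A [ x ]≔ true
    A′ = B [ x ]≔ false
    B″ = B [ y ]≔ true
    A″ = A [ z ]≔ false
    x∈B′ : lookup B′ x ≡ true
    x∈B′ = lookup∘update x A true
    x∈B″ : lookup B″ x ≡ true
    x∈B″ = trans (lookup∘update′ (separated B y∉B x∈B) B true) x∈B
    ∣A″∣≡k : ∣ A″ ∣ ≡ k
    ∣A″∣≡k = suc-injective (trans (∣remove∣ A z∈A) ∣A∣≡suc)
    open ≡-Reasoning
    claw′ : ClawSet n r (join false B′ A′)
    claw′ = join-clawSet B′ A′ disj′ (begin
      ∣ B′ ∣ + ∣ A′ ∣      ≡⟨ cong (_+ ∣ A′ ∣) (∣insert∣ A x∉A) ⟩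
      suc ∣ A ∣ + ∣ A′ ∣   ≡⟨ +-suc ∣ A ∣ ∣ A′ ∣ ⟨
      ∣ A ∣ + suc ∣ A′ ∣   ≡⟨ cong (∣ A ∣ +_) (∣remove∣ B x∈B) ⟩
      ∣ A ∣ + ∣ B ∣        ≡⟨ +-comm ∣ A ∣ ∣ B ∣ ⟩
      ∣ B ∣ + ∣ A ∣        ≡⟨ ∣B∣+∣A∣≡r B A S∈ ⟩
      r ∎)
      where
      disj′ : ∀ i → lookup B′ i ≡ true → ¬ (lookup A′ i ≡ true)
      disj′ i i∈B′ i∈A′ with lookup-insert A x i∈B′ | lookup-remove B x i∈A′
      ... | inj₁ i≡x | i≢x , _   = i≢x i≡x
      ... | inj₂ i∈A | _ , i∈B = disj i i∈B i∈A
    claw″ : ClawSet n r (join false B″ A″)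
    claw″ = join-clawSet B″ A″ disj″ (begin
      ∣ B″ ∣ + ∣ A″ ∣      ≡⟨ cong (_+ ∣ A″ ∣) (∣insert∣ B y∉B) ⟩
      suc ∣ B ∣ + ∣ A″ ∣   ≡⟨ +-suc ∣ B ∣ ∣ A″ ∣ ⟨
      ∣ B ∣ + suc ∣ A″ ∣   ≡⟨ cong (∣ B ∣ +_) (∣remove∣ A z∈A) ⟩
      ∣ B ∣ + ∣ A ∣        ≡⟨ ∣B∣+∣A∣≡r B A S∈ ⟩
      r ∎)
      where
      disj″ : ∀ i → lookup B″ i ≡ true → ¬ (lookup A″ i ≡ true)
      disj″ i i∈B″ i∈A″ with lookup-insert B y i∈B″ | lookup-remove A z i∈A″
      ... | inj₁ refl | _ , i∈A = true≢false i∈A y∉A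
      ... | inj₂ i∈B  | _ , i∈A = disj i i∈B i∈A
    S′∈ : f (join false B′ A′) ≡ true
    S′∈ = reflect B A B′ A′ S∈ x∈B claw′ x∈B′ disjB (λ i i∈A i∈A′ → disj i (proj₂ (lookup-remove B x i∈A′)) i∈A)
      where
      disjB : ∀ i → i ≢ x → lookup B i ≡ true → ¬ (lookup B′ i ≡ true)
      disjB i i≢x i∈B i∈B′ with lookup-insert A x i∈B′
      ... | inj₁ i≡x = i≢x i≡x
      ... | inj₂ i∈A = disj i i∈B i∈A
    S″∈ : f (join false B″ A″) ≡ true
    S″∈ = reflect B′ A′ B″ A″ S′∈ x∈B′ claw″ x∈B″ disjB
      (λ i i∈A′ i∈A″ → disj i (proj₂ (lookup-remove B x i∈A′)) (proj₂ (lookup-remove A z i∈A″)))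
      where
      disjB : ∀ i → i ≢ x → lookup B′ i ≡ true → ¬ (lookup B″ i ≡ true)
      disjB i i≢x i∈B′ i∈B″ with lookup-insert A x i∈B′ | lookup-insert B y i∈B″
      ... | inj₁ i≡x | _         = i≢x i≡x
      ... | inj₂ i∈A | inj₁ refl = true≢false i∈A y∉A
      ... | inj₂ i∈A | inj₂ i∈B  = disj i i∈B i∈A

  unshift-star : Star x (shiftAt x f) → Star x f
  unshift-star star S@(β ∷ BA) S∈ with splitAt n BA | lookup S (position (a x)) in a?S | lookup S (position (b x)) in b?S
  ... | _ | true | _ = refl
  ... | _ | false | false = ⊥-elim (true≢false (star S S∈′) a?S)
    where
    S∈′ : shiftAt x f S ≡ true
    -- A set with neither `a x` nor `b x` is fixed by the compression, so it would be a compressed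
    -- member outside the star.
    S∈′ = trans (cong₂ (λ s t → shiftValue s t (f S) (f (swapAt x S))) b?S a?S) S∈
  unshift-star star (true ∷ BA) S∈ | _ | false | true = ⊥-elim (no-cb (claw _ S∈) x refl b?S)
  unshift-star star (false ∷ .(B ++ A)) S∈ | B , A , refl | false | true =
    ⊥-elim (descend _ B A refl S∈ (trans (sym (join-b false B A x)) b?S))

shiftAt-star-≢ : ∀ {x z : Fin n} (f : Subset (1 + (n + n)) → Bool) → z ≢ x → Star z (shiftAt x f) → Star z f
shiftAt-star-≢ {x = x} {z} f z≢x star S S∈ with shift-image (position (b x)) (position (a x)) f S S∈
... | inj₁ S∈′ = star S S∈′
... | inj₂ σS∈ = trans (sym (swapAt-≢ x S (a z) (λ ()) (λ { refl → z≢x refl }))) (star (swapAt x S) σS∈)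

-- Stars and compression at several indices

clawSet? : ∀ n r S → Dec (ClawSet n r S)
clawSet? n r S = map′ (λ (ba∉ , cb∉ , card) → clawSet ba∉ cb∉ card) (λ (clawSet ba∉ cb∉ card) → ba∉ , cb∉ , card)
  (all? (λ i → contains (b i) →-dec ¬? (contains (a i))) ×-dec
   all? (λ i → contains c →-dec ¬? (contains (b i))) ×-dec
   ∣ S ∣ ≟ r)
  where
  contains : (u : ClawVertex n) → Dec (S ∋ u)
  contains u = lookup S (position u) Bool.≟ true

does-true : ∀ {A : Set} (d : Dec A) → does d ≡ true → A
does-true (yes p) _ = p

star : ∀ n r → Fin n → Subset (1 + (n + n)) → Bool
star n r x S = does (clawSet? n r S) ∧ lookup S (position (a x))

∧-true : ∀ {β γ} → β ∧ γ ≡ true → β ≡ true × γ ≡ true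
∧-true {true} {true} _ = refl , refl

star⁺ : ∀ {x : Fin n} {S} → ClawSet n r S → S ∋ a x → star n r x S ≡ true
star⁺ {S = S} cs x∈ = cong₂ _∧_ (dec-true (clawSet? _ _ S) cs) x∈

star⁻ : ∀ {x : Fin n} S → star n r x S ≡ true → ClawSet n r S × S ∋ a x
star⁻ {n} {r} S S∈ with cs , x∈ ← ∧-true S∈ = does-true (clawSet? n r S) cs , x∈

#_ : (Subset m → Bool) → ℕ
# f = ∑ (λ S → f S · 1)

star-maximal : ∀ {x : Fin n} {f : Subset (1 + (n + n)) → Bool} → (∀ S → f S ≡ true → ClawSet n r S) →
  Star x f → # star n r x ≤ # f → ∀ S → star n r x S ≡ true → f S ≡ true
star-maximal {n} {r} {x} {f} claw star-f large S =
  ·1-cancel (∑-squeeze (λ S → ·-mono 1 λ S∈ → star⁺ (claw S S∈) (star-f S S∈)) large S)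

-- The last component carries a star structure back through all compressions, for an original family
-- at least as large as the star.
compress : ∀ {n r} (X : List (Fin n)) (f : Subset (1 + (n + n)) → Bool) →
  (∀ S → f S ≡ true → ClawSet n r S) → Intersecting f →
  ∃[ g ] (∀ S → g S ≡ true → ClawSet n r S) ×
    Meeting (λ y → ∀ i → i ∈ X → y ≢ position (b i)) g ×
    # f ≤ # g ×
    (2 ≤ r → r < n → ∀ x → # star n r x ≤ # f → Star x g → Star x f)
compress [] f claw meet =
  f , claw , (λ S T S∈ T∈ → let y , y∈S , y∈T , _ = meet S T S∈ T∈ in y , y∈S , y∈T , λ i ()) , ≤-refl ,
  λ _ _ _ _ star-f → star-f
compress {n} {r} (i ∷ X) f claw meet
  with g , claw-g , meet-g , f≤g , lift ← compress X f claw meet =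
  h , claw-h , meet-h , ≤-trans f≤g g≤h , lift-h
  where
  h = shiftAt i g
  claw-h = shiftAt-claw i g claw-g
  g≤h : # g ≤ # h
  g≤h = ∑-shift (position (b i)) (position (a i)) g (λ _ → 1) (λ _ _ _ → ≤-refl)
  meet-h : Meeting (λ y → ∀ j → j ∈ i ∷ X → y ≢ position (b j)) h
  meet-h S T S∈ T∈
    with y , y∈S , y∈T , y∉X , imp ← shift-meeting (position (b i)) (position (a i)) g
           {λ y → ∀ j → j ∈ X → y ≢ position (b j)}
           (λ j _ → position-≢ {u = a i} {b j} (λ ())) meet-g S T S∈ T∈ =
    y , y∈S , y∈T , λ { j (here refl) y≡b → y≢b y≡b ; j (there j∈X) → y∉X j j∈X }
    where
    -- A common `b i` would put its neighbour `a i` into one of the two sets, against independence.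
    y≢b : y ≢ position (b i)
    y≢b refl with imp refl
    ... | inj₁ a∈S = no-ba (claw-h S S∈) i y∈S a∈S
    ... | inj₂ a∈T = no-ba (claw-h T T∈) i y∈T a∈T
  lift-h : 2 ≤ r → r < n → ∀ x → # star n r x ≤ # f → Star x h → Star x f
  lift-h 2≤r r<n x large star-h = lift 2≤r r<n x large star-g
    where
    -- `h` lies inside the star and is at least as large, so it is the whole star, as `Unshift`
    -- demands.
    full : ∀ S → ClawSet n r S → S ∋ a x → h S ≡ true
    full S cs x∈ = star-maximal {f = h} claw-h star-h (≤-trans large (≤-trans f≤g g≤h)) S (star⁺ cs x∈)
    star-g : Star x g
    star-g with x Fin.≟ i
    ... | no x≢i   = shiftAt-star-≢ g x≢i star-h
    ... | yes refl = Unshift.unshift-star 2≤r r<n x g claw-g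
      (λ S T S∈ T∈ → let y , y∈S , y∈T , _ = meet-g S T S∈ T∈ in y , y∈S , y∈T , tt) full star-h

-- Counting independent sets by their leaves

nC0≡1 : ∀ n → n C 0 ≡ 1
nC0≡1 n = trans (nCk≡nC[n∸k] {0} {n} z≤n) (nCn≡1 n)

C-positive : ∀ n k → k ≤ n → 1 ≤ n C k
C-positive n       zero    _         = ≤-reflexive (sym (nC0≡1 n))
C-positive (suc n) (suc k) (s≤s k≤n) =
  ≤-trans (C-positive n k k≤n) (≤-trans (m≤m+n _ _) (≤-reflexive (nCk+nC[k+1]≡[n+1]C[k+1] n k)))

C-< : ∀ n k → k ≤ n → suc (n C suc k) ≤ suc n C suc k
C-< n k k≤n = ≤-trans (+-monoˡ-≤ _ (C-positive n k k≤n)) (≤-reflexive (nCk+nC[k+1]≡[n+1]C[k+1] n k))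

C-monoˡ : ∀ n k → n C k ≤ suc n C k
C-monoˡ n zero    = ≤-reflexive (trans (nC0≡1 n) (sym (nC0≡1 (suc n))))
C-monoˡ n (suc k) = ≤-trans (m≤n+m _ _) (≤-reflexive (nCk+nC[k+1]≡[n+1]C[k+1] n k))

∸-suc : ∀ {n j} → j < n → n ∸ j ≡ suc (n ∸ suc j)
∸-suc {suc n} {zero}  _         = refl
∸-suc {suc n} {suc j} (s≤s j<n) = ∸-suc j<n

-- The numbers of independent r-sets with a given leaf set of size j that avoid, respectively
-- contain, the root.
rootless rooted : (n r : ℕ) → ℕ → ℕ
rootless n r j = (n ∸ j) C (n ∸ r)
rooted n r j = does (suc j ≟ r) · 1

rootless-antitone : Antitone (rootless n r)
rootless-antitone {n} {r} j with n ≤? j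
... | yes n≤j = ≤-reflexive (cong (_C (n ∸ r)) (trans (m≤n⇒m∸n≡0 (m≤n⇒m≤1+n n≤j)) (sym (m≤n⇒m∸n≡0 n≤j))))
... | no n≰j = ≤-trans (C-monoˡ (n ∸ suc j) (n ∸ r)) (≤-reflexive (cong (_C (n ∸ r)) (sym (∸-suc (≰⇒> n≰j)))))

-- By Pascal's rule the difference is `(n ∸ suc j) C (n ∸ suc r)`, which is positive for `j < r`;
-- `r < n` makes the lower index a successor.
rootless-< : r < n → ∀ {j} → j < r → suc (rootless n r (suc j)) ≤ rootless n r j
rootless-< {r} {n} r<n {j} j<r = begin
  suc ((n ∸ suc j) C (n ∸ r))             ≡⟨ cong (λ k → suc ((n ∸ suc j) C k)) (∸-suc r<n) ⟩
  suc ((n ∸ suc j) C suc (n ∸ suc r))     ≤⟨ C-< (n ∸ suc j) (n ∸ suc r) (∸-monoʳ-≤ n (m≤n⇒m≤1+n j<r)) ⟩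
  suc (n ∸ suc j) C suc (n ∸ suc r)       ≡⟨ cong₂ _C_ (sym (∸-suc (<-trans j<r r<n))) (sym (∸-suc r<n)) ⟩
  (n ∸ j) C (n ∸ r) ∎
  where open ≤-Reasoning

rooted≡0 : ∀ {j} → suc j ≢ r → rooted n r j ≡ 0
rooted≡0 {r} {j = j} 1+j≢r = cong (_· 1) (dec-false (suc j ≟ r) 1+j≢r)

rooted≡1 : ∀ {j} → suc j ≡ r → rooted n r j ≡ 1
rooted≡1 {r} {j = j} 1+j≡r = cong (_· 1) (dec-true (suc j ≟ r) 1+j≡r)

rooted≤rootless : ∀ j → rooted n r j ≤ rootless n r (suc j)
rooted≤rootless {n} {r} j with suc j ≟ r
... | yes refl = ≤-reflexive (trans (rooted≡1 {r} {n} {j} refl) (sym (nCn≡1 (n ∸ r))))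
... | no 1+j≢r = ≤-trans (≤-reflexive (rooted≡0 {r} {n} 1+j≢r)) z≤n

-- `rooted` rises only once, by 1, when the size reaches `r - 1`; there the strict drop of
-- `rootless` pays for it.
total-antitone : r < n → Antitone (λ j → rootless n r j + rooted n r j)
total-antitone {r} {n} r<n j with 2 + j ≟ r
... | no 2+j≢r = ≤-trans (≤-reflexive (trans (cong (rootless n r (suc j) +_) (rooted≡0 {r} {n} 2+j≢r)) (+-identityʳ _)))
  (≤-trans (rootless-antitone {n} {r} j) (m≤m+n _ _))
... | yes refl rewrite rooted≡1 {r} {n} {suc j} refl =
  ≤-trans (≤-reflexive (+-comm _ 1)) (≤-trans (rootless-< r<n (s≤s (n≤1+n j))) (m≤m+n _ _))

-- The sum with rooted is still antitone only because r ≥ 4.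
capped : (n r : ℕ) → ℕ → ℕ
capped n r 1 = rootless n r 2
capped n r j = rootless n r j

capped-antitone : Antitone (capped n r)
capped-antitone {n} {r} 0             = ≤-trans (rootless-antitone {n} {r} 1) (rootless-antitone {n} {r} 0)
capped-antitone         1             = ≤-refl
capped-antitone {n} {r} (suc (suc j)) = rootless-antitone {n} {r} (2 + j)

capped-≢1 : ∀ {j} → j ≢ 1 → capped n r j ≡ rootless n r j
capped-≢1 {j = 0}           _   = refl
capped-≢1 {j = 1}           j≢1 = ⊥-elim (j≢1 refl)
capped-≢1 {j = suc (suc j)} _   = refl

capped-≤ : ∀ j → capped n r j ≤ rootless n r j
capped-≤         0             = ≤-refl
capped-≤ {n} {r} 1             = rootless-antitone {n} {r} 1
capped-≤         (suc (suc j)) = ≤-refl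

rooted≤capped : 2 ≤ r → ∀ j → rooted n r j ≤ capped n r (suc j)
rooted≤capped {r} {n} 2≤r zero    = ≤-trans (≤-reflexive (rooted≡0 {r} {n} (<⇒≢ 2≤r))) z≤n
rooted≤capped {r} {n} 2≤r (suc j) = rooted≤rootless {n} {r} (suc j)

-- Capping makes the sizes 1 and 2 weigh the same, so `rooted` must not rise at 2; by `r ≥ 4` it
-- rises only at `r - 1 ≥ 3`. From size 2 on nothing was capped.
capped-total-antitone : r < n → 4 ≤ r → Antitone (λ j → capped n r j + rooted n r j)
capped-total-antitone {r} {n} r<n 4≤r 0
  rewrite rooted≡0 {r} {n} {1} (<⇒≢ (≤-trans (s≤s (s≤s (s≤s z≤n))) 4≤r)) =
  ≤-trans (≤-reflexive (+-identityʳ _)) (≤-trans (capped-antitone {n} {r} 0) (m≤m+n _ _))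
capped-total-antitone {r} {n} r<n 4≤r 1
  rewrite rooted≡0 {r} {n} {2} (<⇒≢ 4≤r) =
  ≤-trans (≤-reflexive (+-identityʳ _)) (m≤m+n _ _)
capped-total-antitone {r} {n} r<n 4≤r (suc (suc j)) = total-antitone {r} {n} r<n (2 + j)

-- Fibres over a given leaf set

Bool-ext : ∀ {β γ} → (β ≡ true → γ ≡ true) → (γ ≡ true → β ≡ true) → β ≡ γ
Bool-ext {true}          imp _   = sym (imp refl)
Bool-ext {false} {true}  _   imp = imp refl
Bool-ext {false} {false} _   _   = refl

_≟ˢ_ : (S T : Subset m) → Dec (S ≡ T)
_≟ˢ_ = ≡-dec Bool._≟_

∑-point : (S : Subset m) (k : ℕ) → ∑ (λ T → does (S ≟ˢ T) · k) ≡ k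
∑-point []          k = refl
∑-point {suc m} (false ∷ S) k = trans (cong₂ _+_ (∑-point S k) (∑-zero m)) (+-identityʳ k)
∑-point {suc m} (true ∷ S)  k = cong₂ _+_ (∑-zero m) (∑-point S k)

-- B and A are disjoint and exactly q points lie outside both.
partition : ℕ → Subset n → Subset n → Bool
partition q       []          []          = does (q ≟ 0)
partition q       (true ∷ B)  (true ∷ A)  = false
partition q       (true ∷ B)  (false ∷ A) = partition q B A
partition q       (false ∷ B) (true ∷ A)  = partition q B A
partition zero    (false ∷ B) (false ∷ A) = false
partition (suc q) (false ∷ B) (false ∷ A) = partition q B A

partition⁺ : ∀ q (B A : Subset n) → (∀ i → lookup B i ≡ true → ¬ (lookup A i ≡ true)) →
  q + (∣ B ∣ + ∣ A ∣) ≡ n → partition q B A ≡ true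
partition⁺ zero    []          []          disj size = refl
partition⁺ q       (true ∷ B)  (true ∷ A)  disj size = ⊥-elim (disj zero refl refl)
partition⁺ q       (true ∷ B)  (false ∷ A) disj size =
  partition⁺ q B A (disj ∘ suc) (suc-injective (trans (sym (+-suc q _)) size))
partition⁺ q       (false ∷ B) (true ∷ A)  disj size =
  partition⁺ q B A (disj ∘ suc) (suc-injective (trans (sym (trans (cong (q +_) (+-suc ∣ B ∣ _)) (+-suc q _))) size))
partition⁺ zero    (false ∷ B) (false ∷ A) disj size =
  ⊥-elim (1+n≰n (≤-trans (≤-reflexive (sym size)) (disjoint-size B A (disj ∘ suc))))
  where
  disjoint-size : ∀ {n} (B A : Subset n) → (∀ i → lookup B i ≡ true → ¬ (lookup A i ≡ true)) → ∣ B ∣ + ∣ A ∣ ≤ n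
  disjoint-size []          []          _    = z≤n
  disjoint-size (true ∷ B)  (true ∷ A)  disj = ⊥-elim (disj zero refl refl)
  disjoint-size (true ∷ B)  (false ∷ A) disj = s≤s (disjoint-size B A (disj ∘ suc))
  disjoint-size (false ∷ B) (true ∷ A)  disj =
    ≤-trans (≤-reflexive (+-suc ∣ B ∣ ∣ A ∣)) (s≤s (disjoint-size B A (disj ∘ suc)))
  disjoint-size (false ∷ B) (false ∷ A) disj = m≤n⇒m≤1+n (disjoint-size B A (disj ∘ suc))
partition⁺ (suc q) (false ∷ B) (false ∷ A) disj size = partition⁺ q B A (disj ∘ suc) (suc-injective size)

partition⁻ : ∀ q (B A : Subset n) → partition q B A ≡ true →
  (∀ i → lookup B i ≡ true → ¬ (lookup A i ≡ true)) × q + (∣ B ∣ + ∣ A ∣) ≡ n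
partition⁻ zero    []          []          _  = (λ ()) , refl
partition⁻ (suc q) []          []          ()
partition⁻ q       (true ∷ B)  (false ∷ A) eq with disj , size ← partition⁻ q B A eq =
  (λ { zero _ () ; (suc i) → disj i }) , trans (+-suc q _) (cong suc size)
partition⁻ q       (false ∷ B) (true ∷ A)  eq with disj , size ← partition⁻ q B A eq =
  (λ { zero () ; (suc i) → disj i }) , trans (trans (cong (q +_) (+-suc ∣ B ∣ _)) (+-suc q _)) (cong suc size)
partition⁻ (suc q) (false ∷ B) (false ∷ A) eq with disj , size ← partition⁻ q B A eq =
  (λ { zero () ; (suc i) → disj i }) , cong suc size

-- `B` is determined by the `q` points left over, chosen among those outside `A`; the recursion is
-- Pascal's rule.
∑-partition : ∀ q (A : Subset n) → ∑ (λ B → partition q B A · 1) ≡ ∣ ∁ A ∣ C q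
∑-partition zero    []          = refl
∑-partition (suc q) []          = sym (k>n⇒nCk≡0 {0} {suc q} (s≤s z≤n))
∑-partition {suc n} q (true ∷ A) = trans (cong₂ _+_ (∑-partition q A) (∑-zero n)) (+-identityʳ _)
∑-partition {suc n} zero (false ∷ A) = trans (cong₂ _+_ (∑-zero n) (∑-partition zero A))
  (trans (nC0≡1 ∣ ∁ A ∣) (sym (nC0≡1 (suc ∣ ∁ A ∣))))
∑-partition {suc n} (suc q) (false ∷ A) = trans (cong₂ _+_ (∑-partition q A) (∑-partition (suc q) A))
  (nCk+nC[k+1]≡[n+1]C[k+1] ∣ ∁ A ∣ q)

clawSets : ∀ n r → Subset (1 + (n + n)) → Bool
clawSets n r S = does (clawSet? n r S)

∑-rootless : r ≤ n → (A : Subset n) → ∑ (λ B → clawSets n r (join false B A) · 1) ≡ rootless n r ∣ A ∣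
∑-rootless {r} {n} r≤n A = begin
  ∑ (λ B → clawSets n r (join false B A) · 1) ≡⟨ ∑-cong (λ B → cong (_· 1) (Bool-ext (to B) (from B))) ⟩
  ∑ (λ B → partition (n ∸ r) B A · 1)         ≡⟨ ∑-partition (n ∸ r) A ⟩
  ∣ ∁ A ∣ C (n ∸ r)                           ≡⟨ cong (_C (n ∸ r)) (∣∁p∣≡n∸∣p∣ A) ⟩
  rootless n r ∣ A ∣ ∎
  where
  open ≡-Reasoning
  to : ∀ B → clawSets n r (join false B A) ≡ true → partition (n ∸ r) B A ≡ true
  to B S∈ with cs ← does-true (clawSet? n r (join false B A)) S∈ =
    partition⁺ (n ∸ r) B A (join-disjoint false B A cs)
      (trans (cong ((n ∸ r) +_) (trans (sym (∣join-false∣ B A)) (ClawSet.card cs))) (m∸n+n≡m r≤n))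
  from : ∀ B → partition (n ∸ r) B A ≡ true → clawSets n r (join false B A) ≡ true
  from B eq with disj , size ← partition⁻ (n ∸ r) B A eq =
    dec-true (clawSet? n r (join false B A)) (join-clawSet B A disj
      (+-cancelˡ-≡ (n ∸ r) _ _ (trans size (sym (m∸n+n≡m r≤n)))))

-- The root excludes every b-vertex, so only the term with empty `B` can survive.
∑-rooted : (A : Subset n) → ∑ (λ B → clawSets n r (join true B A) · 1) ≡ rooted n r ∣ A ∣
∑-rooted {n} {r} A = trans (∑-cong λ B → trans (cong (_· 1) (Bool-ext (to B) (from B))) (∧-· (does (Subset.⊥ ≟ˢ B)) _))
  (∑-point (Subset.⊥ {n}) _)
  where
  ∧-· : ∀ β γ → (β ∧ γ) · 1 ≡ β · (γ · 1)
  ∧-· true  γ = refl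
  ∧-· false γ = refl
  ∣join⊥∣ : ∣ join true Subset.⊥ A ∣ ≡ suc ∣ A ∣
  ∣join⊥∣ = cong suc (trans (∣++∣ (Subset.⊥ {n}) A) (cong (_+ ∣ A ∣) (∣⊥∣≡0 n)))
  to : ∀ B → clawSets n r (join true B A) ≡ true → does (Subset.⊥ ≟ˢ B) ∧ does (suc ∣ A ∣ ≟ r) ≡ true
  to B S∈ with cs ← does-true (clawSet? n r (join true B A)) S∈
    with refl ← lookup-ext {S = Subset.⊥} {B} (λ i → trans (lookup-replicate i false)
                  (sym (¬-not λ i∈B → ClawSet.no-cb cs i refl (trans (join-b true B A i) i∈B)))) =
    cong₂ _∧_ (dec-true (Subset.⊥ {n} ≟ˢ Subset.⊥) refl)
              (dec-true (suc ∣ A ∣ ≟ r) (trans (sym ∣join⊥∣) (ClawSet.card cs)))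
  from : ∀ B → does (Subset.⊥ ≟ˢ B) ∧ does (suc ∣ A ∣ ≟ r) ≡ true → clawSets n r (join true B A) ≡ true
  from B eq with p , q ← ∧-true {does (Subset.⊥ ≟ˢ B)} eq
    with refl ← does-true (Subset.⊥ ≟ˢ B) p =
    dec-true (clawSet? n r (join true B A)) (clawSet (λ i b∈ _ → b∉ i b∈) (λ i _ → b∉ i)
      (trans ∣join⊥∣ (does-true (suc ∣ A ∣ ≟ r) q)))
    where
    b∉ : ∀ (i : Fin n) → ¬ (join true Subset.⊥ A ∋ b i)
    b∉ i b∈ = true≢false b∈ (trans (join-b true Subset.⊥ A i) (lookup-replicate i false))

∑-join : (g : Subset (1 + (n + n)) → ℕ) →
  ∑ g ≡ ∑ {n} (λ A → ∑ {n} (λ B → g (join false B A))) + ∑ {n} (λ A → ∑ {n} (λ B → g (join true B A)))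
∑-join {n} g = cong₂ _+_ (half false) (half true)
  where
  half : ∀ β → ∑ (λ S → g (β ∷ S)) ≡ ∑ {n} (λ A → ∑ {n} (λ B → g (join β B A)))
  half β = trans (∑-++ n _) (∑-comm {n} {n} (λ B A → g (join β B A)))

-- This is the size of the star at one leaf, sorted by the set `S` of its other leaves, in the form
-- in which `weighted-EKR⁺` delivers its bound.
starWeight : (m r : ℕ) → ℕ
starWeight m r = ∑ {m} (λ S → rootless (suc m) r (suc ∣ S ∣) + rooted (suc m) r (suc ∣ S ∣))

#star : ∀ {m r} → r ≤ suc m → # star (suc m) r zero ≡ starWeight m r
#star {m} {r} r≤n = begin
  # star N r zero
    ≡⟨ ∑-join {N} (λ S → star N r zero S · 1) ⟩
  ∑ {N} (λ A → ∑ {N} (λ B → star N r zero (join false B A) · 1)) + ∑ {N} (λ A → ∑ {N} (λ B → star N r zero (join true B A) · 1))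
    ≡⟨ cong₂ _+_ (half false (λ j → rootless N r j) (∑-rootless r≤n)) (half true (λ j → rooted N r j) (∑-rooted {N} {r})) ⟩
  ∑ {m} (λ S → rootless N r (suc ∣ S ∣)) + ∑ {m} (λ S → rooted N r (suc ∣ S ∣))
    ≡⟨ ∑-distrib-+ {m} (λ S → rootless N r (suc ∣ S ∣)) (λ S → rooted N r (suc ∣ S ∣)) ⟨
  starWeight m r ∎
  where
  open ≡-Reasoning
  N = suc m
  half : ∀ β (u : ℕ → ℕ) → (∀ A → ∑ {N} (λ B → clawSets N r (join β B A) · 1) ≡ u ∣ A ∣) →
    ∑ {N} (λ A → ∑ {N} (λ B → star N r zero (join β B A) · 1)) ≡ ∑ {m} (λ S → u (suc ∣ S ∣))
  half β u eq = cong₂ _+_ (trans (∑-cong {m} (λ S → trans (∑-cong {N} (λ B → without B S)) (∑-zero N))) (∑-zero m))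
                          (∑-cong {m} (λ S → trans (∑-cong {N} (λ B → within B S)) (eq (true ∷ S))))
    where
    without : ∀ B S → star N r zero (join β B (false ∷ S)) · 1 ≡ 0
    without B S = cong (_· 1) (trans (cong (clawSets N r (join β B (false ∷ S)) ∧_) (join-a β B (false ∷ S) zero))
                                     (∧-zeroʳ _))
    within : ∀ B S → star N r zero (join β B (true ∷ S)) · 1 ≡ clawSets N r (join β B (true ∷ S)) · 1
    within B S = cong (_· 1) (trans (cong (clawSets N r (join β B (true ∷ S)) ∧_) (join-a β B (true ∷ S) zero))
                                    (∧-identityʳ _))

-- Projection to the root and the leaves

project : ∀ n → (Subset (1 + (n + n)) → Bool) → Subset (1 + n) → Bool
project n f (β ∷ A) = does (anySubset? (λ B → f (join β B A) Bool.≟ true))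

module _ {n r} (r≤n : r ≤ n) (f : Subset (1 + (n + n)) → Bool) (claw : ∀ S → f S ≡ true → ClawSet n r S) where

  ∑-fibre : ∀ β A → ∑ (λ B → f (join β B A) · 1) ≤ project n f (β ∷ A) · ∑ (λ B → clawSets n r (join β B A) · 1)
  ∑-fibre β A with anySubset? (λ B → f (join β B A) Bool.≟ true)
  ... | yes _ = ∑-mono (λ B → ·-mono 1 λ S∈ → dec-true (clawSet? n r (join β B A)) (claw _ S∈))
  ... | no ∄B = ≤-reflexive (trans (∑-cong λ B → cong (_· 1) (¬-not λ S∈ → ∄B (B , S∈))) (∑-zero n))

  #-project : # f ≤ ∑ (λ S → project n f S · weight (rootless n r) (rooted n r) S)
  #-project = ≤-trans (≤-reflexive (∑-join {n} (λ S → f S · 1))) (+-mono-≤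
    (∑-mono λ A → ≤-trans (∑-fibre false A) (≤-reflexive (cong (project n f (false ∷ A) ·_) (∑-rootless r≤n A))))
    (∑-mono λ A → ≤-trans (∑-fibre true A) (≤-reflexive (cong (project n f (true ∷ A) ·_) (∑-rooted {n} {r} A)))))

project⁻ : ∀ n (f : Subset (1 + (n + n)) → Bool) → ∀ β A → project n f (β ∷ A) ≡ true → ∃[ B ] f (join β B A) ≡ true
project⁻ n f β A = does-true (anySubset? (λ B → f (join β B A) Bool.≟ true))

project⁺ : ∀ n (f : Subset (1 + (n + n)) → Bool) → ∀ β B A → f (join β B A) ≡ true → project n f (β ∷ A) ≡ true
project⁺ n f β B A S∈ = dec-true (anySubset? (λ B → f (join β B A) Bool.≟ true)) (B , S∈)

NotB : ∀ n → Fin (1 + (n + n)) → Set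
NotB n y = ∀ i → i ∈ allFin n → y ≢ position (b i)

project-intersecting : {f : Subset (1 + (n + n)) → Bool} →
  Meeting (NotB n) f → Intersecting (project n f)
project-intersecting {n} {f} meet (β ∷ A) (γ ∷ A′) S∈ T∈
  with B , S∈f ← project⁻ n f β A S∈ | B′ , T∈f ← project⁻ n f γ A′ T∈
  with y , y∈S , y∈T , y≢b ← meet (join β B A) (join γ B′ A′) S∈f T∈f =
  at (clawVertex n y) (λ i eq → y≢b i (∈-allFin i) (trans (sym (position-clawVertex y)) (cong position eq)))
     (∋-clawVertex n (join β B A) y y∈S) (∋-clawVertex n (join γ B′ A′) y y∈T)
  where
  at : (u : ClawVertex n) → (∀ i → u ≢ b i) → join β B A ∋ u → join γ B′ A′ ∋ u →
    ∃[ y ] lookup (β ∷ A) y ≡ true × lookup (γ ∷ A′) y ≡ true × ⊤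
  at c     _   u∈S u∈T = zero , u∈S , u∈T , tt
  at (b i) u≢b _   _   = ⊥-elim (u≢b i refl)
  at (a i) _   u∈S u∈T = suc i , trans (sym (join-a β B A i)) u∈S , trans (sym (join-a γ B′ A′ i)) u∈T , tt

module Compressed {m r} (r<n : r < suc m) (g : Subset (1 + (suc m + suc m)) → Bool)
  (claw-g : ∀ S → g S ≡ true → ClawSet (suc m) r S) (meet-g : Meeting (NotB (suc m)) g) where

  private
    N = suc m
    t : Subset (1 + N) → Bool
    t = project N g

    meet-t : Intersecting t
    meet-t = project-intersecting {N} {g} meet-g

    g≤t : # g ≤ ∑ (λ S → t S · weight (rootless N r) (rooted N r) S)
    g≤t = #-project {N} (<⇒≤ r<n) g claw-g

  #≤starWeight : # g ≤ starWeight m r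
  #≤starWeight = ≤-trans g≤t (weighted-EKR⁺ {m = m} {w = rootless N r} {rooted N r} (rootless-antitone {N} {r})
    (rooted≤rootless {N} {r}) (total-antitone {r} {N} r<n) t meet-t)

  private
    Singleton : Subset N → Set
    Singleton A = ∣ A ∣ ≡ 1 × t (false ∷ A) ≡ true

    singleton? : Dec (∃[ A ] Singleton A)
    singleton? = anySubset? (λ A → (∣ A ∣ ≟ 1) ×-dec (t (false ∷ A) Bool.≟ true))

    -- Without a singleton leaf set, lowering its weight to that of pairs costs the projected family
    -- nothing but lowers the bound, which a family of full size then exceeds.
    no-singleton : 4 ≤ r → starWeight m r ≤ # g → ¬ ¬ (∃[ A ] Singleton A)
    no-singleton 4≤r large ∄A = <⇒≱ (rootless-< {r} {N} r<n {1} (≤-trans (s≤s (s≤s z≤n)) 4≤r)) at-⊥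
      where
      lighter : ∀ S → t S · weight (rootless N r) (rooted N r) S ≤ t S · weight (capped N r) (rooted N r) S
      lighter (true ∷ A)  = ≤-refl
      lighter (false ∷ A) with ∣ A ∣ ≟ 1
      ... | no ∣A∣≢1 = ≤-reflexive (cong (t (false ∷ A) ·_) (sym (capped-≢1 {N} {r} ∣A∣≢1)))
      ... | yes ∣A∣≡1 rewrite ¬-not {t (false ∷ A)} (λ A∈ → ∄A (A , ∣A∣≡1 , A∈)) = z≤n
      cappedWeight : ℕ
      cappedWeight = ∑ {m} (λ S → capped N r (suc ∣ S ∣) + rooted N r (suc ∣ S ∣))
      heavy : starWeight m r ≤ cappedWeight
      heavy = ≤-trans large (≤-trans g≤t (≤-trans (∑-mono lighter)
        (weighted-EKR⁺ {m = m} {w = capped N r} {rooted N r} (capped-antitone {N} {r})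
          (rooted≤capped {r} {N} (≤-trans (s≤s (s≤s z≤n)) 4≤r)) (capped-total-antitone {r} {N} r<n 4≤r) t meet-t)))
      at-⊥ : rootless N r 1 ≤ rootless N r 2
      -- Capping would have to leave every term of the star sum unchanged; at the empty `S` the leaf
      -- set is a singleton, where it lowers the weight strictly.
      at-⊥ = subst (λ k → rootless N r (suc k) ≤ capped N r (suc k)) (∣⊥∣≡0 m)
        (+-cancelʳ-≤ (rooted N r (suc ∣ Subset.⊥ {m} ∣)) _ _
          (∑-squeeze {m} (λ S → +-monoˡ-≤ (rooted N r (suc ∣ S ∣)) (capped-≤ {N} {r} (suc ∣ S ∣))) heavy Subset.⊥))

    -- Every projected member meets the singleton, so it contains its only leaf.
    singleton-star : ∀ A → Singleton A → ∃[ x ] Star x g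
    singleton-star A (∣A∣≡1 , A∈) = x , star-g
      where
      x-in = inhabited A ∣A∣≡1
      x = proj₁ x-in
      only-x : ∀ {i} → lookup A i ≡ true → i ≡ x
      only-x {i} i∈A with i Fin.≟ x
      ... | yes i≡x = i≡x
      ... | no i≢x  = ⊥-elim (uninhabited (A [ x ]≔ false)
        (suc-injective (trans (∣remove∣ A (proj₂ x-in)) ∣A∣≡1)) (trans (lookup∘update′ i≢x A false) i∈A))
      star-g : Star x g
      star-g (β ∷ BA) S∈ with B , A′ , refl ← splitAt N BA
        with meet-t (false ∷ A) (β ∷ A′) A∈ (project⁺ N g β B A′ S∈)
      ... | suc i , i∈A , i∈A′ , _ = subst (λ j → join β B A′ ∋ a j) (only-x i∈A) (trans (join-a β B A′ i) i∈A′)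

  large⇒star : 4 ≤ r → starWeight m r ≤ # g → ∃[ x ] Star x g
  large⇒star 4≤r large with singleton?
  ... | no ∄A            = ⊥-elim (no-singleton 4≤r large ∄A)
  ... | yes (A , single) = singleton-star A single

module _ {m r} (r<n : r < suc m) (f : Subset (1 + (suc m + suc m)) → Bool)
  (claw : ∀ S → f S ≡ true → ClawSet (suc m) r S) (meet : Intersecting f) where

  intersecting-# : # f ≤ starWeight m r
  intersecting-# with g , claw-g , meet-g , f≤g , _ ← compress (allFin _) f claw meet =
    ≤-trans f≤g (Compressed.#≤starWeight r<n g claw-g meet-g)

  maximum-star : 4 ≤ r → (∀ x → # star (suc m) r x ≤ # f) → starWeight m r ≤ # f → ∃[ x ] Star x f
  maximum-star 4≤r stars large with g , claw-g , meet-g , f≤g , lift ← compress (allFin _) f claw meet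
    with x , star-g ← Compressed.large⇒star r<n g claw-g meet-g 4≤r (≤-trans large f≤g) =
    x , lift (≤-trans (s≤s (s≤s z≤n)) 4≤r) r<n x (stars x) star-g

-- Families as indicator functions

elements : ∀ {m} → (Subset m → Bool) → List (Subset m)
elements {zero}  f = if f [] then [] ∷ [] else []
elements {suc m} f = map (false ∷_) (elements (λ S → f (false ∷ S))) ++ᴸ map (true ∷_) (elements (λ S → f (true ∷ S)))

length-elements : ∀ {m} (f : Subset m → Bool) → length (elements f) ≡ # f
length-elements {zero} f with f []
... | true  = refl
... | false = refl
length-elements {suc m} f = trans (length-++ (map (false ∷_) (elements (λ S → f (false ∷ S)))))
  (cong₂ _+_ (trans (length-map _ (elements (λ S → f (false ∷ S)))) (length-elements (λ S → f (false ∷ S))))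
             (trans (length-map _ (elements (λ S → f (true ∷ S)))) (length-elements (λ S → f (true ∷ S)))))

elements-unique : ∀ {m} (f : Subset m → Bool) → Unique (elements f)
elements-unique {zero} f with f []
... | true  = [] ∷ []
... | false = []
elements-unique {suc m} f = Unique.++⁺
  (Unique.map⁺ ∷-injectiveʳ (elements-unique (λ S → f (false ∷ S))))
  (Unique.map⁺ ∷-injectiveʳ (elements-unique (λ S → f (true ∷ S))))
  apart
  where
  apart : ∀ {S} → ¬ (S ∈ map (false ∷_) (elements (λ S → f (false ∷ S))) ×
                     S ∈ map (true ∷_) (elements (λ S → f (true ∷ S))))
  apart (S∈ , S∈′) with _ , _ , refl ← ∈-map⁻ (false ∷_) S∈ | _ , _ , () ← ∈-map⁻ (true ∷_) S∈′

elements⁺ : ∀ {m} (f : Subset m → Bool) S → f S ≡ true → S ∈ elements f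
elements⁺ f []          S∈ rewrite S∈ = here refl
elements⁺ f (false ∷ S) S∈ = ∈-++⁺ˡ (∈-map⁺ (false ∷_) (elements⁺ (λ S → f (false ∷ S)) S S∈))
elements⁺ f (true ∷ S)  S∈ = ∈-++⁺ʳ _ (∈-map⁺ (true ∷_) (elements⁺ (λ S → f (true ∷ S)) S S∈))

elements⁻ : ∀ {m} (f : Subset m → Bool) {S} → S ∈ elements f → f S ≡ true
elements⁻ {zero} f S∈ with f [] in eq
elements⁻ {zero} f (here refl) | true = eq
elements⁻ {suc m} f S∈ with ∈-++⁻ (map (false ∷_) (elements (λ S → f (false ∷ S)))) S∈
... | inj₁ S∈′ with S , S∈″ , refl ← ∈-map⁻ (false ∷_) S∈′ = elements⁻ (λ S → f (false ∷ S)) S∈″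
... | inj₂ S∈′ with S , S∈″ , refl ← ∈-map⁻ (true ∷_) S∈′ = elements⁻ (λ S → f (true ∷ S)) S∈″

family : (Subset m → Bool) → Family m
family f = record { members = elements f ; unique = elements-unique f }

_∈ᴸ?_ : (S : Subset m) (L : List (Subset m)) → Dec (S ∈ L)
_∈ᴸ?_ = DecMembership._∈?_ _≟ˢ_

listed : List (Subset m) → Subset m → Bool
listed L S = does (S ∈ᴸ? L)

-- Uniqueness keeps the head out of the tail, so its point indicator adds exactly 1 to the sum.
#-listed : {L : List (Subset m)} → Unique L → # listed L ≡ length L
#-listed {m} []            = ∑-zero m
#-listed {m} {S ∷ L} (S∉L ∷ uniq) = begin
  # listed (S ∷ L)                                                ≡⟨ ∑-cong split ⟩
  ∑ (λ T → does (S ≟ˢ T) · 1 + listed L T · 1)                    ≡⟨ ∑-distrib-+ (λ T → does (S ≟ˢ T) · 1) (λ T → listed L T · 1) ⟩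
  ∑ (λ T → does (S ≟ˢ T) · 1) + # listed L                        ≡⟨ cong₂ _+_ (∑-point S 1) (#-listed uniq) ⟩
  suc (length L) ∎
  where
  open ≡-Reasoning
  split : ∀ T → listed (S ∷ L) T · 1 ≡ does (S ≟ˢ T) · 1 + listed L T · 1
  split T with S ≟ˢ T
  ... | yes refl = trans (cong (_· 1) (dec-true (S ∈ᴸ? (S ∷ L)) (here refl)))
    (cong (λ β → 1 + β · 1) (sym (dec-false (S ∈ᴸ? L) λ S∈L → All.lookup S∉L S∈L refl)))
  ... | no S≢T = cong (_· 1) (Bool-ext
    (λ T∈ → dec-true (T ∈ᴸ? L) (tail (does-true (T ∈ᴸ? (S ∷ L)) T∈)))
    (λ T∈ → dec-true (T ∈ᴸ? (S ∷ L)) (there (does-true (T ∈ᴸ? L) T∈))))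
    where
    tail : T ∈ S ∷ L → T ∈ L
    tail (here refl) = ⊥-elim (S≢T refl)
    tail (there T∈L) = T∈L

indicator : Family m → Subset m → Bool
indicator F = listed (Family.members F)

indicator⁻ : (F : Family m) → ∀ S → indicator F S ≡ true → S ∈ᶠ F
indicator⁻ F S = does-true (S ∈ᴸ? Family.members F)

indicator⁺ : (F : Family m) → ∀ {S} → S ∈ᶠ F → indicator F S ≡ true
indicator⁺ F {S} = dec-true (S ∈ᴸ? Family.members F)

#-indicator : (F : Family m) → # indicator F ≡ size F
#-indicator F = #-listed (Family.unique F)

-- Canonical families and the extremal result

canonical-intersecting : ∀ {G F} → CanonicallyIntersecting G r F → IntersectingFamily G r F
canonical-intersecting (v , spec) =
  (λ A∈ → proj₁ (Equivalence.to (spec _) A∈)) ,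
  (λ A∈ B∈ → v , x∈p∩q⁺ (proj₂ (Equivalence.to (spec _) A∈) , proj₂ (Equivalence.to (spec _) B∈)))

module _ {m r} (r<n : r < suc m) where

  private
    N = suc m
    G = depthTwoClaw N

  starFamily : Fin N → Family (1 + (N + N))
  starFamily x = family (star N r x)

  starFamily-canonical : ∀ x → CanonicallyIntersecting G r (starFamily x)
  starFamily-canonical x = position (a x) , λ S → mk⇔
    (λ S∈ → let cs , x∈ = star⁻ S (elements⁻ (star N r x) S∈) in fromClawSet cs , lookup⇒[]= _ S x∈)
    (λ (indep , x∈) → elements⁺ (star N r x) S (star⁺ (toClawSet indep) ([]=⇒lookup x∈)))

  module _ (F : Family (1 + (N + N))) (inter : IntersectingFamily G r F) where

    indicator-claw : ∀ S → indicator F S ≡ true → ClawSet N r S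
    indicator-claw S S∈ = toClawSet (proj₁ inter (indicator⁻ F S S∈))

    indicator-intersecting : Intersecting (indicator F)
    indicator-intersecting S T S∈ T∈
      with y , y∈ ← proj₂ inter (indicator⁻ F S S∈) (indicator⁻ F T T∈)
      with y∈S , y∈T ← x∈p∩q⁻ S T y∈ = y , []=⇒lookup y∈S , []=⇒lookup y∈T , tt

    size≤starWeight : size F ≤ starWeight m r
    size≤starWeight = subst (_≤ starWeight m r) (#-indicator F)
      (intersecting-# r<n (indicator F) indicator-claw indicator-intersecting)

  -- Only the star at leaf `zero` is counted exactly; for any other leaf the general upper bound
  -- applies to the star itself.
  #star-≤ : ∀ x → # star N r x ≤ starWeight m r
  #star-≤ x = subst (_≤ starWeight m r) (length-elements (star N r x))
    (size≤starWeight (starFamily x) (canonical-intersecting {G = G} {starFamily x} (starFamily-canonical x)))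

  size-starFamily : size (starFamily zero) ≡ starWeight m r
  size-starFamily = trans (length-elements (star N r zero)) (#star (<⇒≤ r<n))

  ekr : EKR G r
  ekr = starWeight m r ,
    ((starFamily zero , canonical-intersecting {G = G} {starFamily zero} (starFamily-canonical zero) , size-starFamily) ,
     size≤starWeight) ,
    ((starFamily zero , starFamily-canonical zero , size-starFamily) ,
     λ F canon → size≤starWeight F (canonical-intersecting {G = G} {F} canon))

  strictlyEKR : 4 ≤ r → StrictlyEKR G r
  strictlyEKR 4≤r = ekr , canonical
    where
    canonical : ∀ F → IntersectingFamily G r F → IsMaxSize (IntersectingFamily G r) (size F) →
      CanonicallyIntersecting G r F
    canonical F inter (_ , maximal) = position (a x) , λ S → mk⇔
      (λ S∈ → proj₁ inter S∈ , lookup⇒[]= _ S (star-F S (indicator⁺ F S∈)))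
      (λ (indep , x∈) → indicator⁻ F S (star-maximal {f = indicator F} claw star-F (stars x) S
        (star⁺ (toClawSet indep) ([]=⇒lookup x∈))))
      where
      claw = indicator-claw F inter
      large : starWeight m r ≤ # indicator F
      -- A family of maximum size is at least as large as the star at `zero`.
      large = subst₂ _≤_ size-starFamily (sym (#-indicator F))
        (maximal (starFamily zero) (canonical-intersecting {G = G} {starFamily zero} (starFamily-canonical zero)))
      stars : ∀ x → # star N r x ≤ # indicator F
      stars x = ≤-trans (#star-≤ x) large
      x-star = maximum-star r<n (indicator F) claw (indicator-intersecting F inter) 4≤r stars large
      x = proj₁ x-star
      star-F = proj₂ x-star

theorem9p3 : (n r : ℕ) → 1 ≤ r → r ≤ n ∸ 1 →
    EKR (depthTwoClaw n) r ×
    (4 ≤ r → r < n ∸ 1 → StrictlyEKR (depthTwoClaw n) r)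
-- For `n = 0` truncated subtraction gives `n ∸ 1 = 0`, leaving no admissible `r`.
theorem9p3 zero    r 1≤r r≤0 = ⊥-elim (1+n≰n (≤-trans 1≤r r≤0))
theorem9p3 (suc m) r 1≤r r≤m = ekr (s≤s r≤m) , λ 4≤r _ → strictlyEKR (s≤s r≤m) 4≤r
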